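{- Let $1<m<10^7$ be a square free integer with $m\equiv 2,3 \pmod 4$. Let $\alpha=\sqrt[4]{m}$ and $K=\mathbb{Q}(\alpha)$. Then, up to equivalence, the only generators of power integral bases in $K$ of the form $\vartheta=x\alpha+y\alpha^2+z\alpha^3$ with $x,y,z\in\mathbb{Z}$ and $\max(|x|,|y|,|z|)<10^{1000}$ are: $(x,y,z)=(1,0,0)$ for arbitrary such $m$, and moreover $(x,\pm y,z)$ for the following values, listed as $m:(x,y,z)$ (each with both signs of $y$): $2:(1,1,1)$; $15:(4,2,1)$; $39:(25,10,4)$; $82:(9,3,1)$; $255:(16,4,1)$; $410:(81,18,4)$; $626:(25,5,1)$; $915:(121,22,4)$; $1295:(36,6,1)$; $2402:(49,7,1)$; $6562:(81,9,1)$; $12155:(441,42,4)$; $14642:(121,11,1)$; $17490:(529,46,4)$; $20735:(144,12,1)$; $24414:(625,50,4)$; $28562:(169,13,1)$; $33215:(729,54,4)$; $38415:(196,14,1)$; $50626:(225,15,1)$; $61535:(3969,252,16)$; $65535:(256,16,1)$; $83522:(289,17,1)$; $130322:(361,19,1)$; $144590:(1521,78,4)$; $159999:(400,20,1)$; $194482:(441,21,1)$; $234255:(484,22,1)$; $279842:(529,23,1)$; $390626:(625,25,1)$; $505679:(6400,240,9)$; $531442:(729,27,1)$; $707282:(841,29,1)$; $757335:(3481,118,4)$; $809999:(900,30,1)$; $923522:(961,31,1)$; $1081730:(16641,516,16)$; $1185922:(1089,33,1)$; $1336335:(1156,34,1)$; $1416695:(4761,138,4)$; $1500626:(1225,35,1)$;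 $1679615:(1296,36,1)$; $1755519:(33124,910,25)$; $1874162:(1369,37,1)$; $1977539:(5625,150,4)$; $2313442:(1521,39,1)$; $2559999:(1600,40,1)$; $2825762:(1681,41,1)$; $3111695:(1764,42,1)$; $3262539:(7225,170,4)$; $3418802:(1849,43,1)$; $3580610:(7569,174,4)$; $3851367:(196249,4430,100)$; $4100626:(2025,45,1)$; $4879682:(2209,47,1)$; $5764802:(2401,49,1)$; $6765202:(2601,51,1)$; $7034430:(10609,206,4)$; $7311615:(2704,52,1)$; $7596914:(11025,210,4)$; $7890482:(2809,53,1)$; $8503055:(2916,54,1)$; $8608519:(105625,1950,36)$; $9150626:(3025,55,1)$; $9834495:(3136,56,1)$.
   Context: For a number field $K$ of degree $n$ with ring of integers $\mathbb{Z}_K$, an element $\gamma\in\mathbb{Z}_K$ generates a power integral basis if $\{1,\gamma,\ldots,\gamma^{n-1}\}$ is an integral basis of $K$. Two elements $\beta,\gamma\in\mathbb{Z}_K$ are called equivalent if $\beta+\gamma\in\mathbb{Z}$ or $\beta-\gamma\in\mathbb{Z}$; generators are considered only up to this equivalence. For $m$ square free with $m\equiv 2,3\pmod 4$, $\{1,\alpha,\alpha^2,\alpha^3\}$ is an integral basis of $K$, so every element of $\mathbb{Z}_K$ is equivalent to one of the form $x\alpha+y\alpha^2+z\alpha^3$ with $x,y,z\in\mathbb{Z}$. -}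

module Defs where

open import Data.Nat as ℕ using (ℕ)
open import Data.Nat.Divisibility using (_∣_)
open import Data.Integer as ℤ using (ℤ; +_; -_; _+_; _*_; _-_)
open import Data.Fin using (Fin; zero; suc)
import Data.Fin
open import Data.Product using (_×_; _,_; ∃-syntax)
open import Data.Sum using (_⊎_)
open import Data.List using (List; []; _∷_)
open import Data.List.Membership.Propositional using (_∈_)
open import Relation.Binary.PropositionalEquality using (_≡_)

SquareFree : ℕ → Set
SquareFree m = ∀ (d : ℕ) → (d ℕ.* d) ∣ m → d ≡ 1

-- Elements of Z_K = Z[α], α⁴ = m, in the integral basis {1, α, α², α³}:
-- ⟨ c0 , c1 , c2 , c3 ⟩ represents c0 + c1 α + c2 α² + c3 α³.
record El : Set where
  constructor ⟨_,_,_,_⟩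
  field
    c0 c1 c2 c3 : ℤ
open El public

zeroE oneE : El
zeroE = ⟨ + 0 , + 0 , + 0 , + 0 ⟩
oneE  = ⟨ + 1 , + 0 , + 0 , + 0 ⟩

addE : El → El → El
addE a b = ⟨ c0 a + c0 b , c1 a + c1 b , c2 a + c2 b , c3 a + c3 b ⟩

subE : El → El → El
subE a b = ⟨ c0 a - c0 b , c1 a - c1 b , c2 a - c2 b , c3 a - c3 b ⟩

scaleE : ℤ → El → El
scaleE k a = ⟨ k * c0 a , k * c1 a , k * c2 a , k * c3 a ⟩

mulE : ℕ → El → El → El
mulE m a b = ⟨ c0 a * c0 b + M * (c1 a * c3 b + c2 a * c2 b + c3 a * c1 b)
             , c0 a * c1 b + c1 a * c0 b + M * (c2 a * c3 b + c3 a * c2 b)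
             , c0 a * c2 b + c1 a * c1 b + c2 a * c0 b + M * (c3 a * c3 b)
             , c0 a * c3 b + c1 a * c2 b + c2 a * c1 b + c3 a * c0 b ⟩
  where M = + m

powE : ℕ → El → ℕ → El
powE m a ℕ.zero    = oneE
powE m a (ℕ.suc k) = mulE m a (powE m a k)

linComb : (Fin 4 → ℤ) → (Fin 4 → El) → El
linComb c b = addE (scaleE (c zero) (b zero))
              (addE (scaleE (c (suc zero)) (b (suc zero)))
              (addE (scaleE (c (suc (suc zero))) (b (suc (suc zero))))
                    (scaleE (c (suc (suc (suc zero)))) (b (suc (suc (suc zero)))))))

IsIntegralBasis : (Fin 4 → El) → Set
IsIntegralBasis b =
  (∀ (v : El) → ∃[ c ] (linComb c b ≡ v)) ×
  (∀ (c : Fin 4 → ℤ) → linComb c b ≡ zeroE → ∀ i → c i ≡ + 0)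

GeneratesPIB : ℕ → El → Set
GeneratesPIB m θ = IsIntegralBasis (λ i → powE m θ (Data.Fin.toℕ i))

InZ : El → Set
InZ e = (c1 e ≡ + 0) × (c2 e ≡ + 0) × (c3 e ≡ + 0)

Equiv : El → El → Set
Equiv β γ = InZ (addE β γ) ⊎ InZ (subE β γ)

elt : ℤ → ℤ → ℤ → El
elt x y z = ⟨ + 0 , x , y , z ⟩

table : List (ℕ × ℤ × ℤ × ℤ)
table =
  (2 , + 1 , + 1 , + 1) ∷
  (15 , + 4 , + 2 , + 1) ∷
  (39 , + 25 , + 10 , + 4) ∷
  (82 , + 9 , + 3 , + 1) ∷
  (255 , + 16 , + 4 , + 1) ∷
  (410 , + 81 , + 18 , + 4) ∷
  (626 , + 25 , + 5 , + 1) ∷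
  (915 , + 121 , + 22 , + 4) ∷
  (1295 , + 36 , + 6 , + 1) ∷
  (2402 , + 49 , + 7 , + 1) ∷
  (6562 , + 81 , + 9 , + 1) ∷
  (12155 , + 441 , + 42 , + 4) ∷
  (14642 , + 121 , + 11 , + 1) ∷
  (17490 , + 529 , + 46 , + 4) ∷
  (20735 , + 144 , + 12 , + 1) ∷
  (24414 , + 625 , + 50 , + 4) ∷
  (28562 , + 169 , + 13 , + 1) ∷
  (33215 , + 729 , + 54 , + 4) ∷
  (38415 , + 196 , + 14 , + 1) ∷
  (50626 , + 225 , + 15 , + 1) ∷
  (61535 , + 3969 , + 252 , + 16) ∷
  (65535 , + 256 , + 16 , + 1) ∷
  (83522 , + 289 , + 17 , + 1) ∷
  (130322 , + 361 , + 19 , + 1) ∷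
  (144590 , + 1521 , + 78 , + 4) ∷
  (159999 , + 400 , + 20 , + 1) ∷
  (194482 , + 441 , + 21 , + 1) ∷
  (234255 , + 484 , + 22 , + 1) ∷
  (279842 , + 529 , + 23 , + 1) ∷
  (390626 , + 625 , + 25 , + 1) ∷
  (505679 , + 6400 , + 240 , + 9) ∷
  (531442 , + 729 , + 27 , + 1) ∷
  (707282 , + 841 , + 29 , + 1) ∷
  (757335 , + 3481 , + 118 , + 4) ∷
  (809999 , + 900 , + 30 , + 1) ∷
  (923522 , + 961 , + 31 , + 1) ∷
  (1081730 , + 16641 , + 516 , + 16) ∷
  (1185922 , + 1089 , + 33 , + 1) ∷
  (1336335 , + 1156 , + 34 , + 1) ∷
  (1416695 , + 4761 , + 138 , + 4) ∷
  (1500626 , + 1225 , + 35 , + 1) ∷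
  (1679615 , + 1296 , + 36 , + 1) ∷
  (1755519 , + 33124 , + 910 , + 25) ∷
  (1874162 , + 1369 , + 37 , + 1) ∷
  (1977539 , + 5625 , + 150 , + 4) ∷
  (2313442 , + 1521 , + 39 , + 1) ∷
  (2559999 , + 1600 , + 40 , + 1) ∷
  (2825762 , + 1681 , + 41 , + 1) ∷
  (3111695 , + 1764 , + 42 , + 1) ∷
  (3262539 , + 7225 , + 170 , + 4) ∷
  (3418802 , + 1849 , + 43 , + 1) ∷
  (3580610 , + 7569 , + 174 , + 4) ∷
  (3851367 , + 196249 , + 4430 , + 100) ∷
  (4100626 , + 2025 , + 45 , + 1) ∷
  (4879682 , + 2209 , + 47 , + 1) ∷
  (5764802 , + 2401 , + 49 , + 1) ∷
  (6765202 , + 2601 , + 51 , + 1) ∷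
  (7034430 , + 10609 , + 206 , + 4) ∷
  (7311615 , + 2704 , + 52 , + 1) ∷
  (7596914 , + 11025 , + 210 , + 4) ∷
  (7890482 , + 2809 , + 53 , + 1) ∷
  (8503055 , + 2916 , + 54 , + 1) ∷
  (8608519 , + 105625 , + 1950 , + 36) ∷
  (9150626 , + 3025 , + 55 , + 1) ∷
  (9834495 , + 3136 , + 56 , + 1) ∷
  []

Listed : ℕ → ℤ → ℤ → ℤ → Set
Listed m x y z = ((m , x , y , z) ∈ table) ⊎ ((m , x , - y , z) ∈ table)

ClaimedGenerator : ℕ → El → Set
ClaimedGenerator m θ =
  Equiv θ (elt (+ 1) (+ 0) (+ 0)) ⊎
  (∃[ x ] ∃[ y ] ∃[ z ] (Listed m x y z × Equiv θ (elt x y z)))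

{-# OPTIONS --safe #-}
module Submission where

-- For θ = xα + yα² + zα³ the determinant of 1, θ, θ², θ³ is N (N² + 4 m t²), where N = x² − m z²
-- and t = x z − y². It is a unit iff N = ±1 and t = 0, that is, up to signs, iff
-- (x , y , z) = (a² , a b , b²) with a⁴ − m b⁴ = ±1. Solutions with a ≤ 500 are found by trial;
-- that there are none with a > 500 in the given range comes from Pell equations.
--
-- If a⁴ − m b⁴ = 1, then a² + 1 = m₁ r⁴ and a² − 1 = m₂ s⁴ for even a, a² + 1 = 2 m₁ r⁴ and
-- a² − 1 = 8 m₂ s⁴ for odd a, with m₁ m₂ = m. One of m₁, m₂ is below 3163 = ⌈√10⁷⌉, so a solves a
-- Pell equation with a small radicand. For each of its solutions in range, either the second
-- coordinate does not come from a square, or no fourth power divides the other factor far enough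
-- to keep m below 10⁷.
--
-- If a⁴ − m b⁴ = −1, then m lies in one of four classes modulo 240, and for each m either the
-- equation is impossible modulo a small prime, or √m has an even period, so that −1 is not a norm,
-- or in every solution of X² − m Z² = −1 in range X or Z is not a square.
--
-- The solutions of a Pell equation are enumerated completely because every solution descends along
-- the continued fraction expansion of √D.

-- The signs are treated differently because a⁴ - 1 factors over the integers and a⁴ + 1 does not.
-- The factorization lowers the radicands from 10⁷ to n and 2 n with n < 3163. For the other sign
-- all m have to be visited, but -1 is a fourth power modulo an odd prime only if the prime is 1
-- modulo 8, so cheap congruences dispose of many m before any continued fraction is needed. The
-- bound 500 has to exceed every a of the table, as no test can reject a true solution; the largest
-- is 443, for m = 3851367. All tests are one-sided: they fail when their fuel runs out. Square
-- roots and units are computed freely, and only the relations that the proof uses are checked. In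
-- particular the unit is never shown to be fundamental; it suffices that every solution with z ≥ 1
-- is this unit times a solution with smaller z.

open import Defs
open import Agda.Builtin.Nat using (div-helper; mod-helper)
open import Data.Bool using (Bool; true; false; not; T; _∧_; _∨_; _xor_; if_then_else_)
open import Data.Bool.ListAction using (any; all)
open import Data.Bool.Properties using (T-∧; T-∨; not-distribˡ-xor; not-involutive)
open import Data.Fin using (Fin; zero; suc)
import Data.Fin
open import Data.Integer using (ℤ; ∣_∣; +_; -[1+_]) renaming (_+_ to _+ᶻ_; _*_ to _*ᶻ_; _-_ to _-ᶻ_; -_ to -ᶻ_)
import Data.Integer.Properties as ℤP
open import Data.Integer.Tactic.RingSolver using () renaming (solve-∀ to solveℤ-∀)
open import Data.List using (List; []; _∷_)
open import Data.List.Membership.Propositional using (_∈_; find)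
open import Data.List.Relation.Unary.All using (lookup)
open import Data.List.Relation.Unary.All.Properties using (all⁺)
open import Data.List.Relation.Unary.Any as Any using (Any; here; there; satisfied)
open import Data.List.Relation.Unary.Any.Properties using (any⁻)
open import Data.Maybe using (Maybe; just; nothing)
open import Data.Nat using (ℕ; zero; suc; _+_; _*_; _∸_; _^_; _/_; _%_; _≤_; _<_; _≤ᵇ_; _<ᵇ_; _≡ᵇ_; z≤n; s≤s; s≤s⁻¹; NonZero; >-nonZero; >-nonZero⁻¹)
open import Data.Nat.Coprimality using (Coprime; coprime-divisor)
import Data.Nat.Coprimality as Coprimality
open import Data.Nat.Divisibility
open import Data.Nat.DivMod hiding (_/_; _%_)
open import Data.Nat.GCD using (gcd; gcd[m,n]∣m; gcd[m,n]∣n; gcd-greatest)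
open import Data.Nat.Properties
open import Data.Nat.Tactic.RingSolver using (solve-∀)
open import Data.Product using (_×_; _,_; ∃-syntax; proj₁; proj₂)
open import Data.Sum using (_⊎_; inj₁; inj₂)
open import Data.Unit using (tt)
open import Function.Bundles using (Equivalence; _⇔_; mk⇔)
open import Relation.Binary.Definitions using (tri<; tri≈; tri>)
open import Relation.Binary.PropositionalEquality
open import Relation.Nullary using (¬_; yes; no; contradiction)

-- Descent along the continued fraction of √D

-- The complete quotient (P + √D) / Q with S = ⌊√D⌋, and C the preceding denominator.
Reduced : ℕ → ℕ → ℕ → ℕ → ℕ → Set
Reduced D S P Q C = P * P + Q * C ≡ D × P ≤ S × Q ≤ S + P

-- Q r² − 2 P r s − C s² = v − u.
Represents : ℕ → ℕ → ℕ → ℕ → ℕ → ℕ → ℕ → Set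
Represents u v Q P C r s = Q * (r * r) + u ≡ 2 * (P * (r * s)) + C * (s * s) + v

square-diff : ∀ p ρ → suc (p + ρ) * suc (p + ρ) ≡ p * p + suc ρ * suc (p + ρ + p)
square-diff = solve-∀

-- This is the passage from (P + √D) / Q to the reciprocal of its fractional part. The norm equation
-- first gives D - P′² + a P′ Q = (a P + C) Q, so Q divides D - P′² and the quotient Q′ is exact;
-- cancelling Q leaves the relation Q′ = C + a (P - P′), stated without subtraction.
nextState : ∀ {D S} P Q C .{{_ : NonZero Q}} → S * S < D → D < suc S * suc S → Reduced D S P Q C →
  let a = (S + P) / Q
      P′ = S ∸ (S + P) % Q
      Q′ = (D ∸ P′ * P′) / Q in
  Reduced D S P′ Q′ Q × P′ + P ≡ a * Q × Q′ + a * P′ ≡ a * P + C × 1 ≤ Q′ × 1 ≤ a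
nextState {D} {S} P Q C lo hi (norm , P≤S , Q≤S+P) =
  (normEq , m∸n≤m S ρ , s≤s⁻¹ Q′<) , sumEq , coeffEq , Q′≥1 , a≥1
  where
  open ≤-Reasoning
  a = (S + P) / Q
  ρ = (S + P) % Q
  P′ = S ∸ ρ
  Q′ = (D ∸ P′ * P′) / Q
  a≥1 : 1 ≤ a
  a≥1 = m≥n⇒m/n>0 Q≤S+P
  division : S + P ≡ ρ + a * Q
  division = m≡m%n+[m/n]*n (S + P) Q
  ρ≤S : ρ ≤ S
  ρ≤S = ≮⇒≥ λ S<ρ → <-irrefl refl (begin-strict
    S + P        <⟨ +-monoˡ-< P S<ρ ⟩
    ρ + P        ≤⟨ +-monoʳ-≤ ρ P≤S ⟩
    ρ + S        ≤⟨ +-monoʳ-≤ ρ (<⇒≤ (<-trans S<ρ (m%n<n (S + P) Q))) ⟩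
    ρ + Q        ≤⟨ +-monoʳ-≤ ρ (m≤n*m Q a {{>-nonZero a≥1}}) ⟩
    ρ + a * Q    ≡⟨ division ⟨
    S + P        ∎)
  S≡ : P′ + ρ ≡ S
  S≡ = m∸n+n≡m ρ≤S
  sumEq : P′ + P ≡ a * Q
  sumEq = +-cancelˡ-≡ ρ _ _ (begin-equality
    ρ + (P′ + P)  ≡⟨ +-assoc ρ P′ P ⟨
    ρ + P′ + P    ≡⟨ cong (_+ P) (trans (+-comm ρ P′) S≡) ⟩
    S + P         ≡⟨ division ⟩
    ρ + a * Q     ∎)
  P′²<D : P′ * P′ < D
  P′²<D = ≤-<-trans (*-mono-≤ (m∸n≤m S ρ) (m∸n≤m S ρ)) lo
  R = D ∸ P′ * P′
  R+ : P′ * P′ + R ≡ D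
  R+ = m+[n∸m]≡n (<⇒≤ P′²<D)
  shuffle : ∀ P P′ X → P * P + X + (P′ + P) * P′ ≡ P′ * P′ + ((P′ + P) * P + X)
  shuffle = solve-∀
  factor : ∀ a Q P C → a * Q * P + Q * C ≡ (a * P + C) * Q
  factor = solve-∀
  swap : ∀ a Q P → a * Q * P ≡ a * P * Q
  swap = solve-∀
  R-eq : R + a * P′ * Q ≡ (a * P + C) * Q
  R-eq = +-cancelˡ-≡ (P′ * P′) _ _ (begin-equality
    P′ * P′ + (R + a * P′ * Q)          ≡⟨ +-assoc (P′ * P′) R _ ⟨
    P′ * P′ + R + a * P′ * Q            ≡⟨ cong₂ _+_ (trans R+ (sym norm)) (sym (swap a Q P′)) ⟩
    P * P + Q * C + a * Q * P′          ≡⟨ cong (λ t → P * P + Q * C + t * P′) sumEq ⟨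
    P * P + Q * C + (P′ + P) * P′       ≡⟨ shuffle P P′ (Q * C) ⟩
    P′ * P′ + ((P′ + P) * P + Q * C)    ≡⟨ cong (λ t → P′ * P′ + (t * P + Q * C)) sumEq ⟩
    P′ * P′ + (a * Q * P + Q * C)       ≡⟨ cong (_+_ (P′ * P′)) (factor a Q P C) ⟩
    P′ * P′ + (a * P + C) * Q           ∎)
  Q∣R : Q ∣ R
  Q∣R = ∣m+n∣m⇒∣n (subst (Q ∣_) (trans (sym R-eq) (+-comm R _)) (n∣m*n (a * P + C))) (n∣m*n (a * P′))
  R≡ : Q′ * Q ≡ R
  R≡ = m/n*n≡m Q∣R
  normEq : P′ * P′ + Q′ * Q ≡ D
  normEq = trans (cong (_+_ (P′ * P′)) R≡) R+
  coeffEq : Q′ + a * P′ ≡ a * P + C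
  coeffEq = *-cancelʳ-≡ _ _ Q (begin-equality
    (Q′ + a * P′) * Q       ≡⟨ *-distribʳ-+ Q Q′ (a * P′) ⟩
    Q′ * Q + a * P′ * Q     ≡⟨ cong (_+ a * P′ * Q) R≡ ⟩
    R + a * P′ * Q          ≡⟨ R-eq ⟩
    (a * P + C) * Q         ∎)
  Q′≥1 : 1 ≤ Q′
  Q′≥1 = n≢0⇒n>0 λ Q′≡0 → <-irrefl (trans (trans (sym (+-identityʳ _)) (cong (λ t → P′ * P′ + t * Q) (sym Q′≡0))) normEq) P′²<D
  -- D - P′² is less than (S + 1)² - P′² = (ρ + 1) (S + 1 + P′), and ρ < Q, so division by Q leaves
  -- less than S + 1 + P′.
  Q′< : Q′ < suc (S + P′)
  Q′< = *-cancelʳ-< Q Q′ (suc (S + P′)) (+-cancelˡ-< (P′ * P′) _ _ (begin-strict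
    P′ * P′ + Q′ * Q                       ≡⟨ normEq ⟩
    D                                      <⟨ hi ⟩
    suc S * suc S                          ≡⟨ cong (λ t → suc t * suc t) S≡ ⟨
    suc (P′ + ρ) * suc (P′ + ρ)            ≡⟨ square-diff P′ ρ ⟩
    P′ * P′ + suc ρ * suc (P′ + ρ + P′)    ≤⟨ +-monoʳ-≤ (P′ * P′) (*-monoˡ-≤ (suc (P′ + ρ + P′)) (m%n<n (S + P) Q)) ⟩
    P′ * P′ + Q * suc (P′ + ρ + P′)        ≡⟨ cong (λ t → P′ * P′ + Q * suc (t + P′)) S≡ ⟩
    P′ * P′ + Q * suc (S + P′)             ≡⟨ cong (_+_ (P′ * P′)) (*-comm Q _) ⟩
    P′ * P′ + suc (S + P′) * Q             ∎))

-- The form is convex in r, negative at r = 0 and at r = a s, hence below -1 strictly between.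
quotient≤ : ∀ {u v a P P′ Q Q′ C} r s → u ≤ 1 → 1 ≤ r → 1 ≤ s → 1 ≤ Q → 1 ≤ C → 1 ≤ Q′ →
  P′ + P ≡ a * Q → Q′ + a * P′ ≡ a * P + C → Represents u v Q P C r s → a * s ≤ r
quotient≤ {u} {v} {a} {P} {P′} {Q} {Q′} {C} r s u≤1 r≥1 s≥1 Q≥1 C≥1 Q′≥1 sumEq coeffEq rep with a * s ≤? r
... | yes as≤r = as≤r
... | no as≰r = contradiction tooBig (<⇒≱ small)
  where
  open ≤-Reasoning
  k = a * s
  w = k ∸ r
  k≡ : r + w ≡ k
  k≡ = m+[n∸m]≡n (<⇒≤ (≰⇒> as≰r))
  w≥1 : 1 ≤ w
  w≥1 = m<n⇒0<n∸m (≰⇒> as≰r)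
  -- For f (r) = Q r² - 2 P r s - C s² one has f (0) = - C s² and f (a s) = - Q′ s². Linear
  -- interpolation between these values, corrected by the quadratic term, gives E = - k f (r)
  -- exactly.
  E = r * (Q′ * (s * s)) + w * (C * (s * s)) + Q * (r * w) * k
  i₁ : ∀ a Q Q′ C P P′ r s w v → (r + w) * (Q * (r * r)) + (r * (Q′ * (s * s)) + w * (C * (s * s)) + Q * (r * w) * (r + w)) + (r + w) * v
     ≡ (r + w) * (Q * (r * (r + w))) + r * (Q′ * (s * s)) + w * (C * (s * s)) + (r + w) * v
  i₁ = solve-∀
  i₂ : ∀ a Q Q′ C P P′ r s w v → a * s * (Q * (r * (a * s))) + r * (Q′ * (s * s)) + w * (C * (s * s)) + a * s * v
     ≡ (a * Q) * (s * r * (a * s)) + r * (Q′ * (s * s)) + w * (C * (s * s)) + a * s * v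
  i₂ = solve-∀
  i₃ : ∀ a Q Q′ C P P′ r s w v → (P′ + P) * (s * r * (a * s)) + r * (Q′ * (s * s)) + w * (C * (s * s)) + a * s * v
     ≡ P * (s * r * (a * s)) + r * (s * s) * (Q′ + a * P′) + w * (C * (s * s)) + a * s * v
  i₃ = solve-∀
  i₄ : ∀ a Q Q′ C P P′ r s w v → P * (s * r * (a * s)) + r * (s * s) * (a * P + C) + w * (C * (s * s)) + a * s * v
     ≡ a * s * (2 * (P * (r * s))) + (r + w) * (C * (s * s)) + a * s * v
  i₄ = solve-∀
  i₅ : ∀ k P r s C v → k * (2 * (P * (r * s))) + k * (C * (s * s)) + k * v ≡ k * (2 * (P * (r * s)) + C * (s * s) + v)
  i₅ = solve-∀
  identity : k * (Q * (r * r)) + E + k * v ≡ k * (Q * (r * r)) + k * u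
  identity = begin-equality
    k * (Q * (r * r)) + E + k * v ≡⟨ cong (λ t → t * (Q * (r * r)) + (r * (Q′ * (s * s)) + w * (C * (s * s)) + Q * (r * w) * t) + t * v) k≡ ⟨
    _ ≡⟨ i₁ a Q Q′ C P P′ r s w v ⟩
    (r + w) * (Q * (r * (r + w))) + r * (Q′ * (s * s)) + w * (C * (s * s)) + (r + w) * v ≡⟨ cong (λ t → t * (Q * (r * t)) + r * (Q′ * (s * s)) + w * (C * (s * s)) + t * v) k≡ ⟩
    _ ≡⟨ i₂ a Q Q′ C P P′ r s w v ⟩
    (a * Q) * (s * r * (a * s)) + r * (Q′ * (s * s)) + w * (C * (s * s)) + a * s * v ≡⟨ cong (λ t → t * (s * r * (a * s)) + r * (Q′ * (s * s)) + w * (C * (s * s)) + a * s * v) sumEq ⟨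
    _ ≡⟨ i₃ a Q Q′ C P P′ r s w v ⟩
    P * (s * r * (a * s)) + r * (s * s) * (Q′ + a * P′) + w * (C * (s * s)) + a * s * v ≡⟨ cong (λ t → P * (s * r * (a * s)) + r * (s * s) * t + w * (C * (s * s)) + a * s * v) coeffEq ⟩
    _ ≡⟨ i₄ a Q Q′ C P P′ r s w v ⟩
    k * (2 * (P * (r * s))) + (r + w) * (C * (s * s)) + k * v ≡⟨ cong (λ t → k * (2 * (P * (r * s))) + t * (C * (s * s)) + k * v) k≡ ⟩
    _ ≡⟨ i₅ k P r s C v ⟩
    k * (2 * (P * (r * s)) + C * (s * s) + v) ≡⟨ cong (k *_) rep ⟨
    k * (Q * (r * r) + u) ≡⟨ *-distribˡ-+ k (Q * (r * r)) u ⟩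
    k * (Q * (r * r)) + k * u ∎
  ss≥1 = *-mono-≤ s≥1 s≥1
  tooBig : suc k ≤ k * u
  tooBig = begin
    suc k                                    ≡⟨ +-comm 1 k ⟩
    k + 1                                    ≡⟨ cong (_+ 1) k≡ ⟨
    r + w + 1                                ≡⟨ cong₂ (λ x y → x + y + 1) (*-identityʳ r) (*-identityʳ w) ⟨
    r * 1 + w * 1 + 1                        ≤⟨ +-mono-≤ (+-mono-≤ (*-monoʳ-≤ r (*-mono-≤ Q′≥1 ss≥1)) (*-monoʳ-≤ w (*-mono-≤ C≥1 ss≥1)))
                                                 (*-mono-≤ (*-mono-≤ Q≥1 (*-mono-≤ r≥1 w≥1)) (≤-trans r≥1 (≤-trans (m≤m+n r w) (≤-reflexive k≡)))) ⟩
    E                                        ≤⟨ m≤m+n E (k * v) ⟩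
    E + k * v                                ≡⟨ +-cancelˡ-≡ (k * (Q * (r * r))) _ _ (trans (sym (+-assoc (k * (Q * (r * r))) E (k * v))) identity) ⟩
    k * u                                    ∎
  small : k * u < suc k
  small = s≤s (≤-trans (*-monoʳ-≤ k u≤1) (≤-reflexive (*-identityʳ k)))

-- Substituting r = a s + r′ interchanges the two variables and the two signs.
nextRepresents : ∀ {u v} a P P′ Q Q′ C r′ s →
  P′ + P ≡ a * Q → Q′ + a * P′ ≡ a * P + C → Represents u v Q P C (a * s + r′) s → Represents v u Q′ P′ Q s r′
nextRepresents {u} {v} a P P′ Q Q′ C r′ s sumEq coeffEq rep = +-cancelˡ-≡ N _ _ (begin-equality
    N + (Q′ * (s * s) + v)                                                                  ≡⟨ i₁ a P P′ Q′ r′ s v ⟩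
    P * (a * (s * s)) + 2 * (P * (s * r′)) + (s * s) * (Q′ + a * P′) + v                     ≡⟨ cong (λ t → P * (a * (s * s)) + 2 * (P * (s * r′)) + (s * s) * t + v) coeffEq ⟩
    P * (a * (s * s)) + 2 * (P * (s * r′)) + (s * s) * (a * P + C) + v                       ≡⟨ i₂ a P C r′ s v ⟩
    2 * (P * ((a * s + r′) * s)) + C * (s * s) + v                                           ≡⟨ rep ⟨
    Q * ((a * s + r′) * (a * s + r′)) + u                                                    ≡⟨ i₃ a Q r′ s u ⟩
    (a * Q) * (a * (s * s)) + 2 * ((a * Q) * (s * r′)) + Q * (r′ * r′) + u                   ≡⟨ cong (λ t → t * (a * (s * s)) + 2 * (t * (s * r′)) + Q * (r′ * r′) + u) sumEq ⟨
    (P′ + P) * (a * (s * s)) + 2 * ((P′ + P) * (s * r′)) + Q * (r′ * r′) + u                 ≡⟨ i₄ a P P′ Q r′ s u ⟩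
    N + (2 * (P′ * (s * r′)) + Q * (r′ * r′) + u)                                            ∎)
  where
  open ≤-Reasoning
  N = P′ * (a * (s * s)) + P * (a * (s * s)) + 2 * (P * (s * r′))
  i₁ : ∀ a P P′ Q′ r′ s v → P′ * (a * (s * s)) + P * (a * (s * s)) + 2 * (P * (s * r′)) + (Q′ * (s * s) + v)
     ≡ P * (a * (s * s)) + 2 * (P * (s * r′)) + (s * s) * (Q′ + a * P′) + v
  i₁ = solve-∀
  i₂ : ∀ a P C r′ s v → P * (a * (s * s)) + 2 * (P * (s * r′)) + (s * s) * (a * P + C) + v ≡ 2 * (P * ((a * s + r′) * s)) + C * (s * s) + v
  i₂ = solve-∀
  i₃ : ∀ a Q r′ s u → Q * ((a * s + r′) * (a * s + r′)) + u ≡ (a * Q) * (a * (s * s)) + 2 * ((a * Q) * (s * r′)) + Q * (r′ * r′) + u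
  i₃ = solve-∀
  i₄ : ∀ a P P′ Q r′ s u → (P′ + P) * (a * (s * s)) + 2 * ((P′ + P) * (s * r′)) + Q * (r′ * r′) + u
     ≡ P′ * (a * (s * s)) + P * (a * (s * s)) + 2 * (P * (s * r′)) + (2 * (P′ * (s * r′)) + Q * (r′ * r′) + u)
  i₄ = solve-∀

plus : Bool → ℕ
plus true  = 1
plus false = 0

plus≤1 : ∀ σ → plus σ ≤ 1
plus≤1 true  = s≤s z≤n
plus≤1 false = z≤n

-- x² − D z² = 1 for true and −1 for false.
Pell : Bool → ℕ → ℕ → ℕ → Set
Pell σ D x z = x * x + plus (not σ) ≡ D * (z * z) + plus σ

record Solution (D S : ℕ) (σ : Bool) (P Q C r s : ℕ) : Set where
  constructor solution
  field
    reduced    : Reduced D S P Q C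
    represents : Represents (plus (not σ)) (plus σ) Q P C r s
    r≥1        : 1 ≤ r

complement≥1 : ∀ {D S P Q C} → S * S < D → Reduced D S P Q C → 1 ≤ C
complement≥1 {D} {S} {P} {Q} {zero} lo (norm , P≤S , _) = contradiction (*-mono-≤ P≤S P≤S) (<⇒≱ (<-≤-trans lo (≤-reflexive (begin
  D                ≡⟨ norm ⟨
  P * P + Q * 0    ≡⟨ cong (_+_ (P * P)) (*-zeroʳ Q) ⟩
  P * P + 0        ≡⟨ +-identityʳ (P * P) ⟩
  P * P            ∎))))
  where open ≡-Reasoning
complement≥1 {C = suc _} _ _ = s≤s z≤n

-- At s = 0 the form is Q r² ≥ 2, which is not ±1. So the descent can stop only where Q = 1.
s≥1 : ∀ {D S σ P q C r s} → Solution D S σ P (suc (suc q)) C r s → 1 ≤ s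
s≥1 {s = suc _} _ = s≤s z≤n
s≥1 {σ = σ} {P} {q} {C} {r} {zero} (solution _ rep r≥1) = contradiction (begin
  2                                             ≤⟨ *-mono-≤ (s≤s (s≤s (z≤n {q}))) (*-mono-≤ r≥1 r≥1) ⟩
  suc (suc q) * (r * r)                         ≤⟨ m≤m+n _ (plus (not σ)) ⟩
  suc (suc q) * (r * r) + plus (not σ)          ≡⟨ rep ⟩
  2 * (P * (r * 0)) + C * 0 + plus σ            ≡⟨ cong₂ (λ x y → x + y + plus σ) (trans (cong (λ t → 2 * (P * t)) (*-zeroʳ r)) (cong (2 *_) (*-zeroʳ P))) (*-zeroʳ C) ⟩
  plus σ                                        ≤⟨ plus≤1 σ ⟩
  1                                             ∎) λ { (s≤s ()) }
  where open ≤-Reasoning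

descend : ∀ {D S σ} P Q {C r s} .{{_ : NonZero Q}} → S * S < D → D < suc S * suc S →
  Solution D S σ P Q C r s → 1 ≤ s →
  let a = (S + P) / Q
      P′ = S ∸ (S + P) % Q in
  1 ≤ a × ∃[ r′ ] (r ≡ a * s + r′ × Solution D S (not σ) P′ ((D ∸ P′ * P′) / Q) Q s r′)
descend {D} {S} {σ} P Q {C} {r} {s} lo hi (solution red rep r≥1) s≥1 =
  advance (nextState P Q C lo hi red)
  where
  a = (S + P) / Q
  advance : ∀ {P′ Q′} → Reduced D S P′ Q′ Q × P′ + P ≡ a * Q × Q′ + a * P′ ≡ a * P + C × 1 ≤ Q′ × 1 ≤ a →
            1 ≤ a × ∃[ r′ ] (r ≡ a * s + r′ × Solution D S (not σ) P′ Q′ Q s r′)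
  advance {P′} {Q′} (red′ , sumEq , coeffEq , Q′≥1 , a≥1) = a≥1 , r ∸ a * s , sym split , solution red′ rep″ s≥1
    where
    as≤r : a * s ≤ r
    as≤r = quotient≤ {u = plus (not σ)} {v = plus σ} {a = a} {P = P} {P′ = P′} {Q = Q} {Q′ = Q′} {C = C}
             r s (plus≤1 (not σ)) r≥1 s≥1 (>-nonZero⁻¹ Q) (complement≥1 {S = S} {P = P} {Q = Q} lo red) Q′≥1 sumEq coeffEq rep
    split : a * s + (r ∸ a * s) ≡ r
    split = m+[n∸m]≡n as≤r
    rep′ : Represents (plus σ) (plus (not σ)) Q′ P′ Q s (r ∸ a * s)
    rep′ = nextRepresents {plus (not σ)} {plus σ} a P P′ Q Q′ C (r ∸ a * s) s sumEq coeffEq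
             (subst (λ t → Represents (plus (not σ)) (plus σ) Q P C t s) (sym split) rep)
    rep″ : Represents (plus (not (not σ))) (plus (not σ)) Q′ P′ Q s (r ∸ a * s)
    rep″ = subst (λ b → Represents (plus b) (plus (not σ)) Q′ P′ Q s (r ∸ a * s)) (sym (not-involutive σ)) rep′

2≤radicand : ∀ {S D} → 1 ≤ S → S * S < D → 2 ≤ D
2≤radicand S≥1 lo = ≤-trans (s≤s (*-mono-≤ S≥1 S≥1)) lo

pell-x≥1 : ∀ {σ D x z} → 2 ≤ D → Pell σ D x z → 1 ≤ x
pell-x≥1 {x = suc _} _ _ = s≤s z≤n
pell-x≥1 {true} {D} {zero} {z} D≥2 eq = contradiction (trans eq (+-comm _ 1)) λ ()
pell-x≥1 {false} {D} {zero} {zero} D≥2 eq = contradiction (trans eq (trans (+-identityʳ _) (*-zeroʳ D))) λ ()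
pell-x≥1 {false} {D} {zero} {suc z} D≥2 eq = contradiction
  (≤-trans (*-mono-≤ D≥2 (s≤s (z≤n {z + z * suc z}))) (≤-reflexive (sym (trans eq (+-identityʳ _))))) λ { (s≤s ()) }

-- For Q = 1 the form is a norm: since P² + C = D, it equals (r - P s)² - D s².
terminal : ∀ {D S σ P C r s} → 2 ≤ D → Solution D S σ P 1 C r s →
  ∃[ x ] (r ≡ P * s + x × Pell σ D x s × 1 ≤ x)
terminal {D} {S} {σ} {P} {C} {r} {s} D≥2 (solution (norm , _ , _) rep r≥1) =
  r ∸ P * s , sym split , pell , pell-x≥1 {σ} {z = s} D≥2 pell
  where
  open ≤-Reasoning
  -- If r < P s, the form is at most r² - 2 (r + 1) r, which is below -1.
  Ps≤r : P * s ≤ r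
  Ps≤r = ≮⇒≥ λ r<Ps → <-irrefl refl (begin-strict
    1 * (r * r) + plus (not σ)                     ≤⟨ +-monoʳ-≤ (1 * (r * r)) (plus≤1 (not σ)) ⟩
    1 * (r * r) + 1                                <⟨ +-monoʳ-< (1 * (r * r)) (*-monoʳ-≤ 2 r≥1) ⟩
    1 * (r * r) + 2 * r                            ≤⟨ m≤m+n _ (r * r) ⟩
    1 * (r * r) + 2 * r + r * r                    ≡⟨ i₁ r ⟩
    2 * (suc r * r)                                ≤⟨ *-monoʳ-≤ 2 (*-monoˡ-≤ r r<Ps) ⟩
    2 * (P * s * r)                                ≡⟨ cong (2 *_) (trans (*-assoc P s r) (cong (P *_) (*-comm s r))) ⟩
    2 * (P * (r * s))                              ≤⟨ m≤m+n _ (C * (s * s)) ⟩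
    2 * (P * (r * s)) + C * (s * s)                ≤⟨ m≤m+n _ (plus σ) ⟩
    2 * (P * (r * s)) + C * (s * s) + plus σ       ≡⟨ rep ⟨
    1 * (r * r) + plus (not σ)                     ∎)
    where
    i₁ : ∀ r → 1 * (r * r) + 2 * r + r * r ≡ 2 * (suc r * r)
    i₁ = solve-∀
  x = r ∸ P * s
  split : P * s + x ≡ r
  split = m+[n∸m]≡n Ps≤r
  j₁ : ∀ P s x u → P * s * (P * s) + 2 * (P * s * x) + (x * x + u) ≡ 1 * ((P * s + x) * (P * s + x)) + u
  j₁ = solve-∀
  j₂ : ∀ P s x C v → 2 * (P * ((P * s + x) * s)) + C * (s * s) + v ≡ P * s * (P * s) + 2 * (P * s * x) + ((P * P + 1 * C) * (s * s) + v)
  j₂ = solve-∀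
  pell : x * x + plus (not σ) ≡ D * (s * s) + plus σ
  pell = +-cancelˡ-≡ (P * s * (P * s) + 2 * (P * s * x)) _ _ (begin-equality
    P * s * (P * s) + 2 * (P * s * x) + (x * x + plus (not σ))             ≡⟨ j₁ P s x _ ⟩
    1 * ((P * s + x) * (P * s + x)) + plus (not σ)                          ≡⟨ cong (λ t → 1 * (t * t) + plus (not σ)) split ⟩
    1 * (r * r) + plus (not σ)                                              ≡⟨ rep ⟩
    2 * (P * (r * s)) + C * (s * s) + plus σ                                ≡⟨ cong (λ t → 2 * (P * (t * s)) + C * (s * s) + plus σ) split ⟨
    2 * (P * ((P * s + x) * s)) + C * (s * s) + plus σ                      ≡⟨ j₂ P s x C _ ⟩
    P * s * (P * s) + 2 * (P * s * x) + ((P * P + 1 * C) * (s * s) + plus σ) ≡⟨ cong (λ t → P * s * (P * s) + 2 * (P * s * x) + (t * (s * s) + plus σ)) norm ⟩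
    P * s * (P * s) + 2 * (P * s * x) + (D * (s * s) + plus σ)              ∎)

start : ∀ {σ D S x z} → 1 ≤ S → 1 ≤ x → Pell σ D x z → Solution D S σ 0 1 D x z
start {σ} {D} S≥1 x≥1 eq = solution (+-identityʳ D , z≤n , ≤-trans S≥1 (≤-reflexive (sym (+-identityʳ _))))
  (trans (cong (_+ plus (not σ)) (+-identityʳ _)) eq) x≥1

-- Even periods and the equation x² - D z² = -1

T-∧⁻ : ∀ {x y} → T (x ∧ y) → T x × T y
T-∧⁻ = Equivalence.to T-∧

T-∨⁻ : ∀ {x y} → T (x ∨ y) → T x ⊎ T y
T-∨⁻ = Equivalence.to T-∨

T-not⁻ : ∀ {x} → T (not x) → ¬ T x
T-not⁻ {false} _ ()

bracketed : ℕ → ℕ → Bool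
bracketed S D = (1 ≤ᵇ S) ∧ (S * S <ᵇ D) ∧ (D <ᵇ suc S * suc S)

bracketed-sound : ∀ S D → T (bracketed S D) → 1 ≤ S × S * S < D × D < suc S * suc S
bracketed-sound S D t with T-∧⁻ {1 ≤ᵇ S} t
... | p , t′ with T-∧⁻ {S * S <ᵇ D} t′
... | q , r = ≤ᵇ⇒≤ 1 S p , <ᵇ⇒< (S * S) D q , <ᵇ⇒< D (suc S * suc S) r

-- The walks run through the states (P , Q) until Q = 1. Here div-helper 0 q k q and
-- mod-helper 0 q k q are k / suc q and k % suc q, written so that they evaluate in one step.
-- An exhausted walk reports an odd period, which excludes nothing.
evenWalk oddWalk evenStep oddStep : ℕ → ℕ → ℕ → ℕ → ℕ → Bool
evenWalk n       D S P zero          = true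
evenWalk n       D S P 1             = false
evenWalk zero    D S P (suc (suc q)) = true
evenWalk (suc n) D S P (suc (suc q)) = oddStep n D S (S ∸ mod-helper 0 (suc q) (S + P) (suc q)) (suc q)
oddWalk n D S P zero          = true
oddWalk n D S P 1             = true
oddWalk n D S P (suc (suc q)) = evenStep n D S (S ∸ mod-helper 0 (suc q) (S + P) (suc q)) (suc q)
evenStep n D S P q = evenWalk n D S P (div-helper 0 q (D ∸ P * P) q)
oddStep  n D S P q = oddWalk n D S P (div-helper 0 q (D ∸ P * P) q)

-- The initial state (0 , 1) has Q = 1 itself, so one step is taken before the walk may stop.
oddPeriod : ℕ → ℕ → ℕ → Bool
oddPeriod n D S = oddStep n D S (S ∸ mod-helper 0 0 (S + 0) 0) 0

Smaller : ℕ → ℕ → Bool → ℕ → Set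
Smaller D S σ N = ∃[ P ] ∃[ C ] ∃[ r ] ∃[ s ] (Solution D S σ P 1 C r s × r + s ≤ N)

remainder≤ : ∀ {a r r′ s} → 1 ≤ a → r ≡ a * s + r′ → s + r′ ≤ r
remainder≤ {a} {r} {r′} {s} a≥1 eq = ≤-trans (+-monoˡ-≤ r′ (m≤n*m s a {{>-nonZero a≥1}})) (≤-reflexive (sym eq))

Descended : ℕ → ℕ → Bool → ℕ → ℕ → ℕ → ℕ → ℕ → ℕ → Set
Descended D S σ a P Q C r s = 1 ≤ a × ∃[ r′ ] (r ≡ a * s + r′ × Solution D S σ P Q C s r′)

evenWalk-sound : ∀ {D S σ C r s N} n P Q → S * S < D → D < suc S * suc S → r + s ≤ N →
  T (not (evenWalk n D S P Q)) → Solution D S σ P Q C r s → Smaller D S σ N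
oddWalk-sound : ∀ {D S σ C r s N} n P Q → S * S < D → D < suc S * suc S → r + s ≤ N →
  T (not (oddWalk n D S P Q)) → Solution D S σ P Q C r s → Smaller D S (not σ) N
oddStep-sound : ∀ {D S σ C r s N} n a P Q → S * S < D → D < suc S * suc S → r + s ≤ N →
  T (not (oddWalk n D S P Q)) → Descended D S (not σ) a P Q C r s → Smaller D S σ N
evenStep-sound : ∀ {D S σ C r s N} n a P Q → S * S < D → D < suc S * suc S → r + s ≤ N →
  T (not (evenWalk n D S P Q)) → Descended D S σ a P Q C r s → Smaller D S σ N
evenWalk-sound n P 1 lo hi le t sol = P , _ , _ , _ , sol , le
evenWalk-sound {D} {S} {σ} {C} {r} {s} {N} (suc n) P (suc (suc q)) lo hi le t sol =
  oddStep-sound {D} {S} {σ} {suc (suc q)} {r} {s} {N} n ((S + P) / suc (suc q)) (S ∸ (S + P) % suc (suc q)) _ lo hi le t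
    (descend {D} {S} {σ} P (suc (suc q)) {C} {r} {s} lo hi sol (s≥1 sol))
oddWalk-sound {D} {S} {σ} {C} {r} {s} {N} n P (suc (suc q)) lo hi le t sol =
  evenStep-sound {D} {S} {not σ} {suc (suc q)} {r} {s} {N} n ((S + P) / suc (suc q)) (S ∸ (S + P) % suc (suc q)) _ lo hi le t
    (descend {D} {S} {σ} P (suc (suc q)) {C} {r} {s} lo hi sol (s≥1 sol))
oddStep-sound {D} {S} {σ} {s = s} {N} n a P Q lo hi le t (a≥1 , r′ , eq , sol) = subst (λ σ → Smaller D S σ N) (not-involutive σ)
  (oddWalk-sound {D} {S} {not σ} n P Q lo hi (≤-trans (remainder≤ {a} {s = s} a≥1 eq) (≤-trans (m≤m+n _ s) le)) t sol)
evenStep-sound {D} {S} {σ} {s = s} n a P Q lo hi le t (a≥1 , r′ , eq , sol) =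
  evenWalk-sound {D} {S} {σ} n P Q lo hi (≤-trans (remainder≤ {a} {s = s} a≥1 eq) (≤-trans (m≤m+n _ s) le)) t sol

smallerPell : ∀ {D S σ N} → 2 ≤ D → Smaller D S σ N → ∃[ x ] ∃[ z ] (Pell σ D x z × x + z ≤ N)
smallerPell {D} {σ = σ} {N} D≥2 (P , C , r , s , sol , le) = conclude (terminal {σ = σ} {P} {C} {r} {s} D≥2 sol)
  where
  conclude : ∃[ x ] (r ≡ P * s + x × Pell σ D x s × 1 ≤ x) → ∃[ x ] ∃[ z ] (Pell σ D x z × x + z ≤ N)
  conclude (x , r≡ , eq , _) = x , s , eq , ≤-trans (+-monoˡ-≤ s (≤-trans (m≤n+m x (P * s)) (≤-reflexive (sym r≡)))) le

-- Every step of the descent changes the sign, so an even period leads from a solution for -1 to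
-- another one for -1. It is smaller, because after the first step the sum of the pair is at most x.
-- Infinite descent then rules out all solutions.
smallerNegative : ∀ n D S → 1 ≤ S → S * S < D → D < suc S * suc S → T (not (oddPeriod n D S)) →
  ∀ x z → 1 ≤ z → Pell false D x z → ∃[ x′ ] ∃[ z′ ] (Pell false D x′ z′ × x′ + z′ < x + z)
smallerNegative n D S S≥1 lo hi odd x z z≥1 eq = conclude (descend {D} {S} {false} 0 1 {D} {x} {z} lo hi (start S≥1 x≥1 eq) z≥1)
  where
  x≥1 = pell-x≥1 {false} {D} {x} {z} (2≤radicand S≥1 lo) eq
  conclude : Descended D S true ((S + 0) / 1) (S ∸ (S + 0) % 1) ((D ∸ (S ∸ (S + 0) % 1) * (S ∸ (S + 0) % 1)) / 1) 1 x z →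
             ∃[ x′ ] ∃[ z′ ] (Pell false D x′ z′ × x′ + z′ < x + z)
  conclude (a≥1 , r′ , split , sol) = shrink (smallerPell {σ = false} (2≤radicand S≥1 lo)
      (oddWalk-sound {D} {S} {true} n (S ∸ (S + 0) % 1) _ lo hi (remainder≤ {(S + 0) / 1} {s = z} a≥1 split) odd sol))
    where
    shrink : ∃[ x′ ] ∃[ z′ ] (Pell false D x′ z′ × x′ + z′ ≤ x) → ∃[ x′ ] ∃[ z′ ] (Pell false D x′ z′ × x′ + z′ < x + z)
    shrink (x′ , z′ , eq′ , le) = x′ , z′ , eq′ , ≤-<-trans le (m<m+n x z≥1)

noNegative : ∀ n D S → T (bracketed S D) → T (not (oddPeriod n D S)) → ∀ x z → ¬ Pell false D x z
noNegative n D S br odd x z = go (suc (x + z)) x z ≤-refl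
  where
  bounds = bracketed-sound S D br
  go : ∀ k x z → x + z < k → ¬ Pell false D x z
  go k x zero _ eq = contradiction (trans (+-comm 1 (x * x)) (trans eq (trans (+-identityʳ _) (*-zeroʳ D)))) λ ()
  go (suc k) x z@(suc _) lt eq =
    let x′ , z′ , eq′ , lt′ = smallerNegative n D S (proj₁ bounds) (proj₁ (proj₂ bounds)) (proj₂ (proj₂ bounds)) odd x z (s≤s z≤n) eq
    in go k x′ z′ (<-≤-trans lt′ (s≤s⁻¹ lt)) eq′

-- The unit read off from one period, and its powers

-- The unit x₁ + z₁ √D, of norm −1 when flip is true.
record Unit : Set where
  constructor unit
  field
    flip : Bool
    x₁ z₁ : ℕ

-- The arguments x , x₀ and z , z₀ are numerators and denominators of two successive convergents,
-- and b records the parity of the number of steps. At Q = 1 the classical identities x₀ + P x = D z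
-- and z₀ + P z = x are tested instead of proved.
fundFrom : ℕ → ℕ → ℕ → ℕ → ℕ → Bool → ℕ → ℕ → ℕ → ℕ → Maybe Unit
fundStep : ℕ → ℕ → ℕ → ℕ → ℕ → ℕ → Bool → ℕ → ℕ → ℕ → ℕ → Maybe Unit
fundNext : ℕ → ℕ → ℕ → ℕ → ℕ → Bool → ℕ → ℕ → ℕ → ℕ → Maybe Unit
fundFrom zero    D S P Q             b x x₀ z z₀ = nothing
fundFrom (suc n) D S P zero          b x x₀ z z₀ = nothing
fundFrom (suc n) D S P 1             b x x₀ z z₀ =
  if (x₀ + P * x ≡ᵇ D * z) ∧ (z₀ + P * z ≡ᵇ x) then just (unit b x z) else nothing
fundFrom (suc n) D S P (suc (suc q)) b x x₀ z z₀ =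
  fundStep n D S P (suc q) (div-helper 0 (suc q) (S + P) (suc q)) (not b) x x₀ z z₀
fundStep n D S P q a b x x₀ z z₀ = fundNext n D S (S ∸ mod-helper 0 q (S + P) q) q b (a * x + x₀) x (a * z + z₀) z
fundNext n D S P q b x x₀ z z₀ = fundFrom n D S P (div-helper 0 q (D ∸ P * P) q) b x x₀ z z₀

fundamentalUnit : ℕ → ℕ → ℕ → Maybe Unit
fundamentalUnit n D S = fundStep n D S 0 0 (div-helper 0 0 (S + 0) 0) true 1 0 0 1

-- In other words, x + z √D = (x₁ + z₁ √D) (x′ + z′ √D), and the sign of the cofactor differs from σ
-- exactly when the unit has norm -1.
Factors : ℕ → Bool → Unit → ℕ → ℕ → Set
Factors D σ (unit e x₁ z₁) x z = ∃[ x′ ] ∃[ z′ ] (Pell (e xor σ) D x′ z′ × 1 ≤ x′ ×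
  x ≡ x₁ * x′ + D * (z₁ * z′) × z ≡ z₁ * x′ + x₁ * z′)

-- The invariant is that the matrix of convergents applied to the current pair (r , s) returns the
-- original solution. At Q = 1, inserting r = P s + x′ and the two tested identities turns this into
-- multiplication by the unit.
fundFrom-sound : ∀ {D S σ C r s ε} n P Q b x x₀ z z₀ → 2 ≤ D → S * S < D → D < suc S * suc S →
  fundFrom n D S P Q b x x₀ z z₀ ≡ just ε → Solution D S (b xor σ) P Q C r s →
  Factors D σ ε (x * r + x₀ * s) (z * r + z₀ * s)
fundStep-sound : ∀ {D S σ C r s ε} n a P Q b x x₀ z z₀ → 2 ≤ D → S * S < D → D < suc S * suc S →
  fundFrom n D S P Q (not b) (a * x + x₀) x (a * z + z₀) z ≡ just ε → Descended D S (not (b xor σ)) a P Q C r s →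
  Factors D σ ε (x * r + x₀ * s) (z * r + z₀ * s)
fundFrom-sound {D} {S} {σ} {C} {r} {s} (suc n) P 1 b x x₀ z z₀ D≥2 lo hi eq sol
  with x₀ + P * x ≡ᵇ D * z in eq₁ | z₀ + P * z ≡ᵇ x in eq₂
fundFrom-sound {D} {S} {σ} {C} {r} {s} (suc n) P 1 b x x₀ z z₀ D≥2 lo hi refl sol | true | true =
  conclude (terminal {σ = b xor σ} {P} {C} {r} {s} D≥2 sol)
  where
  e₁ : x₀ + P * x ≡ D * z
  e₁ = ≡ᵇ⇒≡ _ _ (subst T (sym eq₁) _)
  e₂ : z₀ + P * z ≡ x
  e₂ = ≡ᵇ⇒≡ _ _ (subst T (sym eq₂) _)
  i₁ : ∀ x x₀ P s x′ → x * (P * s + x′) + x₀ * s ≡ x * x′ + (x₀ + P * x) * s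
  i₁ = solve-∀
  conclude : ∃[ x′ ] (r ≡ P * s + x′ × Pell (b xor σ) D x′ s × 1 ≤ x′) → Factors D σ (unit b x z) (x * r + x₀ * s) (z * r + z₀ * s)
  conclude (x′ , refl , pell , x′≥1) = x′ , s , pell , x′≥1 ,
    trans (i₁ x x₀ P s x′) (cong (_+_ (x * x′)) (trans (cong (_* s) e₁) (*-assoc D z s))) ,
    trans (i₁ z z₀ P s x′) (cong (λ t → z * x′ + t * s) e₂)
fundFrom-sound {D} {S} {σ} {C} {r} {s} (suc n) P (suc (suc q)) b x x₀ z z₀ D≥2 lo hi eq sol =
  fundStep-sound {D} {S} {σ} {suc (suc q)} {r} {s} n ((S + P) / suc (suc q)) (S ∸ (S + P) % suc (suc q)) _ b x x₀ z z₀ D≥2 lo hi eq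
    (descend {D} {S} {b xor σ} P (suc (suc q)) {C} {r} {s} lo hi sol (s≥1 sol))
fundStep-sound {D} {S} {σ} {C} {r} {s} {ε} n a P Q b x x₀ z z₀ D≥2 lo hi eq (a≥1 , r′ , refl , sol) =
  subst₂ (Factors D σ ε) (i₁ x) (i₁ z)
    (fundFrom-sound n P Q (not b) _ _ _ _ D≥2 lo hi eq (subst (λ τ → Solution D S τ P Q C s r′) (not-distribˡ-xor b σ) sol))
  where
  i₁ : ∀ x {x₀} → (a * x + x₀) * s + x * r′ ≡ x * (a * s + r′) + x₀ * s
  i₁ x {x₀} = i₂ a x x₀ s r′
    where
    i₂ : ∀ a x x₀ s r′ → (a * x + x₀) * s + x * r′ ≡ x * (a * s + r′) + x₀ * s
    i₂ = solve-∀

fundamentalUnit-sound : ∀ {D S σ ε x z} n → T (bracketed S D) → fundamentalUnit n D S ≡ just ε →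
  1 ≤ z → Pell σ D x z → Factors D σ ε x z
fundamentalUnit-sound {D} {S} {σ} {ε} {x} {z} n br eq z≥1 pell =
  subst₂ (Factors D σ ε) (trans (+-identityʳ _) (+-identityʳ x)) (+-identityʳ z)
    (fundStep-sound {D} {S} {σ} {1} {x} {z} n ((S + 0) / 1) (S ∸ (S + 0) % 1) _ false 1 0 0 1 D≥2 lo hi eq
      (descend {D} {S} {σ} 0 1 {D} {x} {z} lo hi (start S≥1 (pell-x≥1 {σ} {D} {x} {z} D≥2 pell) pell) z≥1))
  where
  bounds = bracketed-sound S D br
  S≥1 = proj₁ bounds
  lo = proj₁ (proj₂ bounds)
  hi = proj₂ (proj₂ bounds)
  D≥2 = 2≤radicand S≥1 lo

-- Runs the test t on the powers of ε until the first coordinate reaches B.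
orbit : ℕ → (Bool → ℕ → ℕ → Bool) → ℕ → Unit → ℕ → Bool → ℕ → ℕ → Bool
orbit zero    t D ε                B σ x z = false
orbit (suc n) t D ε@(unit e x₁ z₁) B σ x z =
  (B ≤ᵇ x) ∨ (t σ x z ∧ orbit n t D ε B (e xor σ) (x₁ * x + D * (z₁ * z)) (z₁ * x + x₁ * z))

data Orbit (D : ℕ) (ε : Unit) : Bool → ℕ → ℕ → Set where
  base : Orbit D ε true 1 0
  next : ∀ {σ x z} → Orbit D ε σ x z → let open Unit ε in
         Orbit D ε (flip xor σ) (x₁ * x + D * (z₁ * z)) (z₁ * x + x₁ * z)

pell-trivial : ∀ {σ D x} → Pell σ D x 0 → 1 ≤ x → σ ≡ true × x ≡ 1
pell-trivial {true}  {D} {suc zero}    eq x≥1 = refl , refl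
pell-trivial {true}  {D} {suc (suc x)} eq x≥1 = contradiction (trans eq (cong (_+ 1) (*-zeroʳ D))) λ ()
pell-trivial {false} {D} {suc x}       eq x≥1 = contradiction (trans eq (trans (+-identityʳ _) (*-zeroʳ D))) λ ()

xor-cancel : ∀ e σ → e xor (e xor σ) ≡ σ
xor-cancel true  σ = not-involutive σ
xor-cancel false σ = refl

-- Dividing by the unit lowers z strictly, since z = z₁ x′ + x₁ z′ with z₁ x′ ≥ 1 and x₁ ≥ 1.
-- Repeated division ends at z = 0, where the solution is 1.
pell⇒orbit : ∀ {D} ε → 2 ≤ D → 1 ≤ Unit.x₁ ε → 1 ≤ Unit.z₁ ε →
  (∀ σ x z → 1 ≤ z → Pell σ D x z → Factors D σ ε x z) → ∀ σ x z → Pell σ D x z → Orbit D ε σ x z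
pell⇒orbit {D} ε@(unit e x₁ z₁) D≥2 x₁≥1 z₁≥1 factors σ x z = go (suc z) σ x z ≤-refl
  where
  go : ∀ k σ x z → z < k → Pell σ D x z → Orbit D ε σ x z
  extend : ∀ k σ x z → z ≤ k → Factors D σ ε x z → Orbit D ε σ x z
  go (suc k) σ x zero lt pell with pell-trivial {σ} {D} {x} pell (pell-x≥1 {σ} {D} {x} {0} D≥2 pell)
  ... | refl , refl = base
  go (suc k) σ x z@(suc _) lt pell = extend k σ x z (s≤s⁻¹ lt) (factors σ x z (s≤s z≤n) pell)
  extend k σ x z le (x′ , z′ , pell , x′≥1 , x≡ , z≡) =
    subst (λ τ → Orbit D ε τ x z) (xor-cancel e σ)
      (subst₂ (Orbit D ε (e xor (e xor σ))) (sym x≡) (sym z≡) (next (go k (e xor σ) x′ z′ (<-≤-trans z′<z le) pell)))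
    where
    open ≤-Reasoning
    z′<z : z′ < z
    z′<z = begin-strict
      z′                 ≤⟨ m≤n*m z′ x₁ {{>-nonZero x₁≥1}} ⟩
      x₁ * z′            <⟨ m<n+m (x₁ * z′) (*-mono-≤ z₁≥1 x′≥1) ⟩
      z₁ * x′ + x₁ * z′  ≡⟨ z≡ ⟨
      z                  ∎

-- The first coordinate never decreases along the orbit, so the run is not cut off by B before an
-- element with x < B. The fuel left is a successor because the run fails at fuel zero; hence the
-- test was really applied to the element.
orbit-reaches : ∀ {t D B n σ x z} ε → 1 ≤ Unit.x₁ ε → T (orbit n t D ε B true 1 0) → Orbit D ε σ x z → x < B →
  ∃[ k ] T (orbit (suc k) t D ε B σ x z)
orbit-reaches {n = suc n} ε x₁≥1 ok base lt = n , ok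
orbit-reaches {t} {D} {B} {n} ε@(unit e x₁ z₁) x₁≥1 ok (next {σ} {x} {z} o) lt =
  continue (orbit-reaches {n = n} ε x₁≥1 ok o x<B)
  where
  x<B : x < B
  x<B = ≤-<-trans (≤-trans (m≤n*m x x₁ {{>-nonZero x₁≥1}}) (m≤m+n (x₁ * x) _)) lt
  continue : ∃[ k ] T (orbit (suc k) t D ε B σ x z) → ∃[ k ] T (orbit (suc k) t D ε B (e xor σ) _ _)
  continue (k , ok′) with T-∨⁻ {B ≤ᵇ x} ok′
  ... | inj₁ B≤x = contradiction (≤ᵇ⇒≤ B x B≤x) (<⇒≱ x<B)
  ... | inj₂ rest with k | proj₂ (T-∧⁻ {t σ x z} rest)
  ... | suc k′ | ok″ = k′ , ok″

orbit-sound : ∀ {t D B n σ x z} ε → 1 ≤ Unit.x₁ ε → T (orbit n t D ε B true 1 0) → Orbit D ε σ x z → x < B → T (t σ x z)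
orbit-sound {t} {D} {B} {n} {σ} {x} {z} ε x₁≥1 ok o lt = conclude (orbit-reaches {n = n} ε x₁≥1 ok o lt)
  where
  conclude : ∃[ k ] T (orbit (suc k) t D ε B σ x z) → T (t σ x z)
  conclude (k , ok′) with T-∨⁻ {B ≤ᵇ x} ok′
  ... | inj₁ B≤x = contradiction (≤ᵇ⇒≤ B x B≤x) (<⇒≱ lt)
  ... | inj₂ rest = proj₁ (T-∧⁻ {t σ x z} rest)

orbitOf : ℕ → (Bool → ℕ → ℕ → Bool) → ℕ → ℕ → Maybe Unit → Bool
orbitOf n t D B nothing = false
orbitOf n t D B (just ε@(unit _ x₁ z₁)) = (1 ≤ᵇ x₁) ∧ (1 ≤ᵇ z₁) ∧ orbit n t D ε B true 1 0

allSolutions : ℕ → (Bool → ℕ → ℕ → Bool) → ℕ → ℕ → ℕ → Bool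
allSolutions n t B D S = bracketed S D ∧ orbitOf n t D B (fundamentalUnit n D S)

allSolutions-sound : ∀ n t B D S → T (allSolutions n t B D S) → ∀ σ x z → Pell σ D x z → x < B → T (t σ x z)
allSolutions-sound n t B D S ok σ x z pell x<B =
  conclude (fundamentalUnit n D S) refl (proj₂ (T-∧⁻ {bracketed S D} ok))
  where
  br = proj₁ (T-∧⁻ {bracketed S D} ok)
  D≥2 : 2 ≤ D
  D≥2 = 2≤radicand (proj₁ (bracketed-sound S D br)) (proj₁ (proj₂ (bracketed-sound S D br)))
  conclude : ∀ u → fundamentalUnit n D S ≡ u → T (orbitOf n t D B u) → T (t σ x z)
  conclude (just ε@(unit _ x₁ z₁)) eq ok′ with T-∧⁻ {1 ≤ᵇ x₁} ok′
  ... | x₁≥1 , ok″ with T-∧⁻ {1 ≤ᵇ z₁} ok″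
  ... | z₁≥1 , ok‴ = orbit-sound {n = n} ε x₁≥1′ ok‴
      (pell⇒orbit ε D≥2 x₁≥1′ (≤ᵇ⇒≤ 1 z₁ z₁≥1) (λ σ x z → fundamentalUnit-sound {σ = σ} n br eq) σ x z pell) x<B
    where
    x₁≥1′ = ≤ᵇ⇒≤ 1 x₁ x₁≥1

-- The equation a⁴ + 1 = m b⁴

infix 30 _⁴
_⁴ : ℕ → ℕ
a ⁴ = a * a * (a * a)

allBelow : ℕ → (ℕ → Bool) → Bool
allBelow zero    p = true
allBelow (suc n) p = p n ∧ allBelow n p

-- Comparing two types T b makes Agda evaluate b, so expensive checks are kept behind a record.
record Verified (b : Bool) : Set where
  constructor verified
  field
    isTrue : b ≡ true

holds : ∀ {b} → Verified b → T b
holds (verified refl) = _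

allBelow-sound : ∀ n p → T (allBelow n p) → ∀ {i} → i < n → T (p i)
allBelow-sound (suc n) p ok {i} i<1+n with T-∧⁻ {p n} ok | m<1+n⇒m<n∨m≡n i<1+n
... | pn , rest | inj₁ i<n = allBelow-sound n p rest i<n
... | pn , rest | inj₂ refl = pn

verified-below : ∀ n p → Verified (allBelow n p) → ∀ {i} → i < n → T (p i)
verified-below n p v = allBelow-sound n p (holds v)

-- Squares and fourth powers modulo small numbers

_∣ᵇ_ : ℕ → ℕ → Bool
zero    ∣ᵇ n = false
(suc k) ∣ᵇ n = n % suc k ≡ᵇ 0

∣ᵇ⇒∣ : ∀ d n → T (d ∣ᵇ n) → d ∣ n
∣ᵇ⇒∣ (suc k) n t = m%n≡0⇒n∣m n (suc k) (≡ᵇ⇒≡ (n % suc k) 0 t)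

∣⇒∣ᵇ : ∀ d n → 1 ≤ d → d ∣ n → T (d ∣ᵇ n)
∣⇒∣ᵇ (suc k) n _ d∣n = ≡⇒≡ᵇ (n % suc k) 0 (n∣m⇒m%n≡0 n (suc k) d∣n)

%-cong-* : ∀ ℓ .{{_ : NonZero ℓ}} {a a′ b b′} → a % ℓ ≡ a′ % ℓ → b % ℓ ≡ b′ % ℓ → (a * b) % ℓ ≡ (a′ * b′) % ℓ
%-cong-* ℓ {a} {a′} {b} {b′} p q = begin
  (a * b) % ℓ                  ≡⟨ %-distribˡ-* a b ℓ ⟩
  ((a % ℓ) * (b % ℓ)) % ℓ      ≡⟨ cong₂ (λ x y → (x * y) % ℓ) p q ⟩
  ((a′ % ℓ) * (b′ % ℓ)) % ℓ    ≡⟨ %-distribˡ-* a′ b′ ℓ ⟨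
  (a′ * b′) % ℓ                ∎
  where open ≡-Reasoning

%-cong-suc : ∀ ℓ .{{_ : NonZero ℓ}} {a a′} → a % ℓ ≡ a′ % ℓ → (a + 1) % ℓ ≡ (a′ + 1) % ℓ
%-cong-suc ℓ {a} {a′} p = begin
  (a + 1) % ℓ                ≡⟨ %-distribˡ-+ a 1 ℓ ⟩
  ((a % ℓ) + (1 % ℓ)) % ℓ    ≡⟨ cong (λ x → (x + (1 % ℓ)) % ℓ) p ⟩
  ((a′ % ℓ) + (1 % ℓ)) % ℓ   ≡⟨ %-distribˡ-+ a′ 1 ℓ ⟨
  (a′ + 1) % ℓ               ∎
  where open ≡-Reasoning

⁴-% : ∀ ℓ .{{_ : NonZero ℓ}} a → a ⁴ % ℓ ≡ (a % ℓ) ⁴ % ℓ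
⁴-% ℓ a = %-cong-* ℓ square square
  where
  square : (a * a) % ℓ ≡ ((a % ℓ) * (a % ℓ)) % ℓ
  square = %-distribˡ-* a a ℓ

-- The number x can have hundreds of digits; its residue is handed over as an argument in order to
-- be computed once for all r.
nonResidue : ℕ → ℕ → Bool
nonResidueClass : ℕ → ℕ → Bool
nonResidue zero    x = false
nonResidue (suc k) x = nonResidueClass k (x % suc k)
nonResidueClass k c = allBelow (suc k) λ r → not ((r * r) % suc k ≡ᵇ c)

nonResidue-sound : ∀ ℓ x r → T (nonResidue ℓ x) → x ≢ r * r
nonResidue-sound ℓ@(suc k) x r ok x≡r² = T-not⁻ {((r % ℓ) * (r % ℓ)) % ℓ ≡ᵇ x % ℓ}
  (allBelow-sound ℓ (λ r → not ((r * r) % ℓ ≡ᵇ x % ℓ)) ok (m%n<n r ℓ))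
  (≡⇒≡ᵇ _ (x % ℓ) (trans (sym (%-distribˡ-* r r ℓ)) (cong (_% ℓ) (sym x≡r²))))

-- Explicit lists make the first sieve a mere lookup. Only their completeness matters for soundness,
-- and `squareResidues-ok` checks it.
squareResidues : List (ℕ × List ℕ)
squareResidues = (16 , 0 ∷ 1 ∷ 4 ∷ 9 ∷ []) ∷ (9 , 0 ∷ 1 ∷ 4 ∷ 7 ∷ []) ∷ (5 , 0 ∷ 1 ∷ 4 ∷ []) ∷ (7 , 0 ∷ 1 ∷ 2 ∷ 4 ∷ []) ∷ (11 , 0 ∷ 1 ∷ 3 ∷ 4 ∷ 5 ∷ 9 ∷ []) ∷ (13 , 0 ∷ 1 ∷ 3 ∷ 4 ∷ 9 ∷ 10 ∷ 12 ∷ []) ∷ []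

moduli : List ℕ
moduli = 64 ∷ 17 ∷ 19 ∷ 23 ∷ 29 ∷ 31 ∷ 37 ∷ 41 ∷ 43 ∷ 47 ∷ 53 ∷ 59 ∷ 61 ∷ 67 ∷
  71 ∷ 73 ∷ 79 ∷ 83 ∷ 89 ∷ 97 ∷ 101 ∷ 103 ∷ 107 ∷ []

infix 4 _∈ᵇ_
_∈ᵇ_ : ℕ → List ℕ → Bool
c ∈ᵇ cs = any (c ≡ᵇ_) cs

unlisted : ℕ → ℕ × List ℕ → Bool
unlisted x (zero  , cs) = false
unlisted x (suc k , cs) = not (x % suc k ∈ᵇ cs)

allSquaresListed : ℕ × List ℕ → Bool
allSquaresListed (zero  , cs) = true
allSquaresListed (suc k , cs) = allBelow (suc k) λ r → (r * r) % suc k ∈ᵇ cs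

abstract
  squareResidues-ok : Verified (all allSquaresListed squareResidues)
  squareResidues-ok = verified refl

unlisted-sound : ∀ e x r → T (allSquaresListed e) → T (unlisted x e) → x ≢ r * r
unlisted-sound (ℓ@(suc k) , cs) x r ok u x≡r² = T-not⁻ {x % ℓ ∈ᵇ cs} u
  (subst (λ c → T (c ∈ᵇ cs)) (trans (sym (%-distribˡ-* r r ℓ)) (cong (_% ℓ) (sym x≡r²)))
    (allBelow-sound ℓ (λ r → (r * r) % ℓ ∈ᵇ cs) ok (m%n<n r ℓ)))

nonSquare : ℕ → Bool
nonSquare x = any (unlisted x) squareResidues ∨ any (λ ℓ → nonResidue ℓ x) moduli

nonSquare-sound : ∀ x r → T (nonSquare x) → x ≢ r * r
nonSquare-sound x r ok with T-∨⁻ {any (unlisted x) squareResidues} ok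
... | inj₁ t with find (any⁻ (unlisted x) squareResidues t)
... | e , e∈ , u = unlisted-sound e x r (lookup (all⁺ allSquaresListed squareResidues (holds squareResidues-ok)) e∈) u
nonSquare-sound x r ok | inj₂ t with satisfied (any⁻ (λ ℓ → nonResidue ℓ x) moduli t)
... | ℓ , t′ = nonResidue-sound ℓ x r t′

newton : ℕ → ℕ → ℕ → ℕ
newtonStep : ℕ → ℕ → ℕ → ℕ → ℕ
newton zero    D t       = t
newton (suc n) D zero    = zero
newton (suc n) D (suc k) = newtonStep n D (suc k) ((suc k + D / suc k) / 2)
newtonStep n D t t′ = if t′ <ᵇ t then newton n D t′ else t

-- Correct for D < 10⁷ only, but never trusted: bracketed rechecks the result.
isqrt : ℕ → ℕ
isqrt D = newton 30 D 4000

excludes : ℕ → ℕ → Bool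
excludes zero      c = false
excludes ℓ@(suc _) c = allBelow ℓ λ a → allBelow ℓ λ b → not ((a ⁴ + 1) % ℓ ≡ᵇ (c * b ⁴) % ℓ)

excludes-sound : ∀ ℓ .{{_ : NonZero ℓ}} m a b → T (excludes ℓ (m % ℓ)) → a ⁴ + 1 ≢ m * b ⁴
excludes-sound ℓ@(suc _) m a b ok eq =
  T-not⁻ {((a % ℓ) ⁴ + 1) % ℓ ≡ᵇ ((m % ℓ) * (b % ℓ) ⁴) % ℓ}
    (allBelow-sound ℓ (λ b → not (((a % ℓ) ⁴ + 1) % ℓ ≡ᵇ ((m % ℓ) * b ⁴) % ℓ))
      (allBelow-sound ℓ (λ a → allBelow ℓ λ b → not ((a ⁴ + 1) % ℓ ≡ᵇ ((m % ℓ) * b ⁴) % ℓ)) ok (m%n<n a ℓ)) (m%n<n b ℓ))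
    (≡⇒≡ᵇ _ (((m % ℓ) * (b % ℓ) ⁴) % ℓ) (begin
      ((a % ℓ) ⁴ + 1) % ℓ            ≡⟨ %-cong-suc ℓ {a ⁴} {(a % ℓ) ⁴} (⁴-% ℓ a) ⟨
      (a ⁴ + 1) % ℓ                  ≡⟨ cong (_% ℓ) eq ⟩
      (m * b ⁴) % ℓ                  ≡⟨ %-cong-* ℓ {m} {m % ℓ} {b ⁴} {(b % ℓ) ⁴} (sym (m%n%n≡m%n m ℓ)) (⁴-% ℓ b) ⟩
      ((m % ℓ) * (b % ℓ) ⁴) % ℓ      ∎))
  where open ≡-Reasoning

noFourthRoot : ℕ → Bool
noFourthRoot q = allBelow q λ a → not (q ∣ᵇ (a ⁴ + 1))

noFourthRoot-sound : ∀ q .{{_ : NonZero q}} a → T (noFourthRoot q) → ¬ q ∣ a ⁴ + 1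
noFourthRoot-sound q@(suc _) a ok q∣ =
  T-not⁻ {q ∣ᵇ ((a % q) ⁴ + 1)} (allBelow-sound q (λ a → not (q ∣ᵇ (a ⁴ + 1))) ok (m%n<n a q))
    (≡⇒≡ᵇ _ 0 (trans (sym (%-cong-suc q {a ⁴} {(a % q) ⁴} (⁴-% q a))) (n∣m⇒m%n≡0 (a ⁴ + 1) q q∣)))

-- Modulo 13 and 29 the values a⁴ + 1 avoid 0 and one of the four cosets of the nonzero fourth
-- powers; the lists are this coset together with 0. So these two primes need not recur among
-- `nonDivisors`.
excludedResidues : List (ℕ × List ℕ)
excludedResidues = (13 , 0 ∷ 7 ∷ 8 ∷ 11 ∷ []) ∷ (29 , 0 ∷ 4 ∷ 5 ∷ 6 ∷ 9 ∷ 13 ∷ 22 ∷ 28 ∷ []) ∷ []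

-- Primes not congruent to 1 modulo 8: modulo these, −1 is not a fourth power.
nonDivisors : List ℕ
nonDivisors = 7 ∷ 11 ∷ 19 ∷ 23 ∷ 31 ∷ 37 ∷ 43 ∷ 47 ∷ 53 ∷ 59 ∷ 61 ∷ 67 ∷ 71 ∷ 79 ∷ 83 ∷ 101 ∷ 103 ∷ 107 ∷ 109 ∷ 127 ∷
  131 ∷ 139 ∷ 149 ∷ 151 ∷ 157 ∷ 163 ∷ 167 ∷ 173 ∷ 179 ∷ 181 ∷ 191 ∷ 197 ∷ 199 ∷ 211 ∷ 223 ∷ 227 ∷ 229 ∷ 239 ∷ 251 ∷ 263 ∷
  269 ∷ 271 ∷ 277 ∷ 283 ∷ 293 ∷ 307 ∷ 311 ∷ 317 ∷ 331 ∷ 347 ∷ 349 ∷ 359 ∷ 367 ∷ 373 ∷ 379 ∷ 383 ∷ 389 ∷ 397 ∷ []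

inExcluded : ℕ → ℕ × List ℕ → Bool
inExcluded m (zero  , cs) = false
inExcluded m (suc k , cs) = any (λ c → m % suc k ≡ᵇ c) cs

obstructed : ℕ → Bool
obstructed m = any (inExcluded m) excludedResidues ∨ any (_∣ᵇ m) nonDivisors

allExclude : ℕ × List ℕ → Bool
allExclude (ℓ , cs) = all (excludes ℓ) cs

abstract
  excludedResidues-ok : Verified (all allExclude excludedResidues)
  excludedResidues-ok = verified refl

  nonDivisors-ok : Verified (all (λ q → (1 ≤ᵇ q) ∧ noFourthRoot q) nonDivisors)
  nonDivisors-ok = verified refl

inExcluded-sound : ∀ m a b e → T (allExclude e) → T (inExcluded m e) → a ⁴ + 1 ≢ m * b ⁴
inExcluded-sound m a b (suc k , cs) ok hit with find (any⁻ (λ c → m % suc k ≡ᵇ c) cs hit)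
... | c , c∈cs , m≡c = excludes-sound (suc k) m a b
  (subst (λ c → T (excludes (suc k) c)) (sym (≡ᵇ⇒≡ (m % suc k) c m≡c)) (lookup (all⁺ (excludes (suc k)) cs ok) c∈cs))

obstructed-sound : ∀ m a b → T (obstructed m) → a ⁴ + 1 ≢ m * b ⁴
obstructed-sound m a b ok eq with T-∨⁻ {any (inExcluded m) excludedResidues} ok
... | inj₁ t with find (any⁻ (inExcluded m) excludedResidues t)
... | e , e∈ , hit = inExcluded-sound m a b e (lookup (all⁺ allExclude excludedResidues (holds excludedResidues-ok)) e∈) hit eq
obstructed-sound m a b ok eq | inj₂ t with find (any⁻ (_∣ᵇ m) nonDivisors t)
... | q , q∈ , hit with T-∧⁻ {1 ≤ᵇ q} (lookup (all⁺ (λ q → (1 ≤ᵇ q) ∧ noFourthRoot q) nonDivisors (holds nonDivisors-ok)) q∈)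
... | q≥1 , root = noFourthRoot-sound q {{>-nonZero (≤ᵇ⇒≤ 1 q q≥1)}} a root (subst (q ∣_) (sym eq) (∣m⇒∣m*n (b ⁴) (∣ᵇ⇒∣ q m hit)))

-- Here x stands for a², so the threshold is 500². Solutions of norm +1 occur in the orbit but carry
-- no condition.
negativeTest : Bool → ℕ → ℕ → Bool
negativeTest true  x z = true
negativeTest false x z = (x ≤ᵇ 250000) ∨ nonSquare x ∨ nonSquare z

-- The parity of the period comes first because it involves only numbers of the size of m, whereas
-- the unit may be enormous. The 6000 is fuel.
noLargeNegative : ℕ → ℕ → ℕ → Bool
noLargeNegative B m S = (bracketed S m ∧ not (oddPeriod 6000 m S)) ∨ allSolutions 6000 negativeTest B m S

settledNegative : ℕ → ℕ → Bool
settledNegative B m = obstructed m ∨ noLargeNegative B m (isqrt m)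

settledRange : ℕ → ℕ → ℕ → Bool
settledRange B zero    m = true
settledRange B (suc n) m = settledNegative B m ∧ settledRange B n (m + 240)

settledRange-sound : ∀ B n m → T (settledRange B n m) → ∀ i → i < n → T (settledNegative B (m + i * 240))
settledRange-sound B (suc n) m ok zero    lt = subst (λ t → T (settledNegative B t)) (sym (+-identityʳ m)) (proj₁ (T-∧⁻ {settledNegative B m} ok))
settledRange-sound B (suc n) m ok (suc i) lt = subst (λ t → T (settledNegative B t)) (+-assoc m 240 (i * 240))
  (settledRange-sound B n (m + 240) (proj₂ (T-∧⁻ {settledNegative B m} ok)) i (s≤s⁻¹ lt))

square≤⇒≤ : ∀ k a → a * a ≤ k * k → a ≤ k
square≤⇒≤ k a le = ≮⇒≥ λ k<a → contradiction (*-mono-< k<a k<a) (≤⇒≯ le)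

settledNegative-sound : ∀ B m a b → T (settledNegative B m) → a ⁴ + 1 ≡ m * b ⁴ → a * a < B → a ≤ 500
settledNegative-sound B m a b ok eq lt with T-∨⁻ {obstructed m} ok
... | inj₁ t = contradiction eq (obstructed-sound m a b t)
... | inj₂ t with T-∨⁻ {bracketed (isqrt m) m ∧ not (oddPeriod 6000 m (isqrt m))} t
... | inj₁ even = contradiction pell
        (noNegative 6000 m (isqrt m) (proj₁ (T-∧⁻ {bracketed (isqrt m) m} even)) (proj₂ (T-∧⁻ {bracketed (isqrt m) m} even)) (a * a) (b * b))
  where
  pell : Pell false m (a * a) (b * b)
  pell = trans eq (sym (+-identityʳ _))
... | inj₂ sols with T-∨⁻ {a * a ≤ᵇ 250000} (allSolutions-sound 6000 negativeTest B m (isqrt m) sols false (a * a) (b * b) (trans eq (sym (+-identityʳ _))) lt)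
... | inj₁ small = square≤⇒≤ 500 a (≤ᵇ⇒≤ (a * a) 250000 small)
... | inj₂ ns with T-∨⁻ {nonSquare (a * a)} ns
... | inj₁ ns₁ = contradiction refl (nonSquare-sound (a * a) a ns₁)
... | inj₂ ns₂ = contradiction refl (nonSquare-sound (b * b) b ns₂)

-- The classes modulo 240 that survive the conditions modulo 16, 3 and 5.
residues : List ℕ
residues = 2 ∷ 82 ∷ 146 ∷ 226 ∷ []

-- Fourth powers are 0 or 1 modulo 16, 3 and 5. Modulo 16, a⁴ + 1 is 1 or 2, so b is odd and m is 1
-- or 2; the condition modulo 4 leaves 2. Modulo 3 and modulo 5, m is 1 or 2. This gives the four
-- classes.
residueCheck : ℕ → Bool
residueCheck c = (c ∈ᵇ residues) ∨ (c % 4 ≤ᵇ 1) ∨ excludes 16 (c % 16) ∨ excludes 3 (c % 3) ∨ excludes 5 (c % 5)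

abstract
  residueCheck-ok : Verified (allBelow 240 residueCheck)
  residueCheck-ok = verified refl

≰1 : ∀ {k} → k ≡ 2 ⊎ k ≡ 3 → ¬ k ≤ 1
≰1 (inj₁ refl) (s≤s ())
≰1 (inj₂ refl) (s≤s ())

residue : ∀ m a b → m % 4 ≡ 2 ⊎ m % 4 ≡ 3 → a ⁴ + 1 ≡ m * b ⁴ → T (m % 240 ∈ᵇ residues)
residue m a b m%4 eq with T-∨⁻ {m % 240 ∈ᵇ residues} (verified-below 240 residueCheck residueCheck-ok (m%n<n m 240))
... | inj₁ t = t
... | inj₂ t with T-∨⁻ {m % 240 % 4 ≤ᵇ 1} t
... | inj₁ le = contradiction (subst (_≤ 1) (m∣n⇒o%n%m≡o%m 4 240 m (divides 60 refl)) (≤ᵇ⇒≤ (m % 240 % 4) 1 le)) (≰1 m%4)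
... | inj₂ t′ with T-∨⁻ {excludes 16 (m % 240 % 16)} t′
... | inj₁ e = contradiction eq (excludes-sound 16 m a b (subst (λ c → T (excludes 16 c)) (m∣n⇒o%n%m≡o%m 16 240 m (divides 15 refl)) e))
... | inj₂ t″ with T-∨⁻ {excludes 3 (m % 240 % 3)} t″
... | inj₁ e = contradiction eq (excludes-sound 3 m a b (subst (λ c → T (excludes 3 c)) (m∣n⇒o%n%m≡o%m 3 240 m (divides 80 refl)) e))
... | inj₂ e = contradiction eq (excludes-sound 5 m a b (subst (λ c → T (excludes 5 c)) (m∣n⇒o%n%m≡o%m 5 240 m (divides 48 refl)) e))

-- The count suffices for all m < 10⁷ in the class, as 41667 · 240 = 10000080.
SettledClass : ℕ → Set
SettledClass c = Verified (settledRange (10 ^ 1000) 41667 c)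

abstract
  class₂ : SettledClass 2
  class₂ = verified refl

  class₈₂ : SettledClass 82
  class₈₂ = verified refl

  class₁₄₆ : SettledClass 146
  class₁₄₆ = verified refl

  class₂₂₆ : SettledClass 226
  class₂₂₆ = verified refl

settledResidue : ∀ c → T (c ∈ᵇ residues) → SettledClass c
settledResidue c t = choose (any⁻ (c ≡ᵇ_) residues t)
  where
  choose : Any (λ d → T (c ≡ᵇ d)) residues → SettledClass c
  choose (here e)                         = subst SettledClass (sym (≡ᵇ⇒≡ c 2 e)) class₂
  choose (there (here e))                 = subst SettledClass (sym (≡ᵇ⇒≡ c 82 e)) class₈₂
  choose (there (there (here e)))         = subst SettledClass (sym (≡ᵇ⇒≡ c 146 e)) class₁₄₆
  choose (there (there (there (here e)))) = subst SettledClass (sym (≡ᵇ⇒≡ c 226 e)) class₂₂₆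

negative-small : ∀ m a b → m < 10 ^ 7 → m % 4 ≡ 2 ⊎ m % 4 ≡ 3 → a ⁴ + 1 ≡ m * b ⁴ → a * a < 10 ^ 1000 → a ≤ 500
negative-small m a b m<10⁷ m%4 eq lt = settledNegative-sound (10 ^ 1000) m a b
  (subst (λ t → T (settledNegative (10 ^ 1000) t)) (sym (m≡m%n+[m/n]*n m 240))
    (settledRange-sound (10 ^ 1000) 41667 (m % 240) (holds (settledResidue (m % 240) (residue m a b m%4 eq))) (m / 240) (m<n*o⇒m/o<n (<-≤-trans m<10⁷ (≤ᵇ⇒≤ (10 ^ 7) (41667 * 240) tt)))))
  eq lt

-- The equation a⁴ = m b⁴ + 1

square-injective : ∀ {a b} → a * a ≡ b * b → a ≡ b
square-injective {a} {b} eq = ≤-antisym (square≤⇒≤ b a (≤-reflexive eq)) (square≤⇒≤ a b (≤-reflexive (sym eq)))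

coprime-∣ : ∀ {x y x′ y′} → x′ ∣ x → y′ ∣ y → Coprime x y → Coprime x′ y′
coprime-∣ x′∣x y′∣y c (d∣x′ , d∣y′) = c (∣-trans d∣x′ x′∣x , ∣-trans d∣y′ y′∣y)

quotients-coprime : ∀ {d m n m′ n′} → 1 ≤ d → (∀ {i} → i ∣ m → i ∣ n → i ∣ d) → m ≡ m′ * d → n ≡ n′ * d → Coprime m′ n′
quotients-coprime {d} {m′ = m′} {n′} d≥1 greatest refl refl {i} (i∣m′ , i∣n′) =
  ∣1⇒≡1 (*-cancelʳ-∣ d {{>-nonZero d≥1}} (subst (i * d ∣_) (sym (*-identityˡ d))
    (greatest (*-monoˡ-∣ d i∣m′) (*-monoˡ-∣ d i∣n′))))

-- Put d = gcd (x , z), x = x′ d, z = z′ d; cancelling d gives x′ y = z′² d. As x′ is coprime to z′,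
-- it divides d; as d is coprime to y, it divides x′. So x = d².
coprime-square : ∀ x y z → Coprime x y → x * y ≡ z * z → ∃[ r ] (x ≡ r * r)
coprime-square zero      y z c eq = 0 , refl
coprime-square x@(suc _) y z c eq with gcd[m,n]∣m x z | gcd[m,n]∣n x z
... | divides x′ x≡ | divides z′ z≡ = d , trans x≡ (cong (_* d) (∣-antisym x′∣d d∣x′))
  where
  open ≡-Reasoning
  d = gcd x z
  d≥1 : 1 ≤ d
  d≥1 = n≢0⇒n>0 λ d≡0 → contradiction (trans x≡ (trans (cong (x′ *_) d≡0) (*-zeroʳ x′))) λ ()
  c′ : Coprime x′ z′
  c′ = quotients-coprime d≥1 gcd-greatest x≡ z≡
  cancelled : x′ * y ≡ z′ * (z′ * d)
  cancelled = *-cancelʳ-≡ (x′ * y) (z′ * (z′ * d)) d {{>-nonZero d≥1}} (begin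
    x′ * y * d             ≡⟨ i₁ x′ y d ⟩
    x′ * d * y             ≡⟨ cong (_* y) x≡ ⟨
    x * y                  ≡⟨ eq ⟩
    z * z                  ≡⟨ cong₂ _*_ z≡ z≡ ⟩
    z′ * d * (z′ * d)      ≡⟨ i₂ z′ d ⟩
    z′ * (z′ * d) * d      ∎)
    where
    i₁ : ∀ x y d → x * y * d ≡ x * d * y
    i₁ = solve-∀
    i₂ : ∀ z d → z * d * (z * d) ≡ z * (z * d) * d
    i₂ = solve-∀
  x′∣d : x′ ∣ d
  x′∣d = coprime-divisor c′ (coprime-divisor c′ (subst (x′ ∣_) cancelled (m∣m*n y)))
  d∣x′ : d ∣ x′
  d∣x′ = coprime-divisor (coprime-∣ (gcd[m,n]∣m x z) ∣-refl c)
    (subst (d ∣_) (trans (sym cancelled) (*-comm x′ y)) (∣n⇒∣m*n z′ (∣n⇒∣m*n z′ ∣-refl)))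

interchange : ∀ x y → x * x * (y * y) ≡ x * y * (x * y)
interchange = solve-∀

coprime-fourth : ∀ x y c → Coprime x y → x * y ≡ c ⁴ → ∃[ r ] ∃[ s ] (x ≡ r ⁴ × y ≡ s ⁴)
coprime-fourth x y c cop eq with coprime-square x y (c * c) cop eq
                               | coprime-square y x (c * c) (Coprimality.sym cop) (trans (*-comm y x) eq)
... | p , refl | q , refl with square-injective {p * q} {c * c} (trans (sym (interchange p q)) eq)
... | pq with coprime-square p q c (coprime-∣ (m∣m*n p) (m∣m*n q) cop) pq
            | coprime-square q p c (Coprimality.sym (coprime-∣ (m∣m*n p) (m∣m*n q) cop)) (trans (*-comm q p) pq)
... | r , refl | s , refl = r , s , refl , refl

Splitting : ℕ → ℕ → ℕ → Set
Splitting m x y = ∃[ m₁ ] ∃[ m₂ ] ∃[ r ] ∃[ s ] (m ≡ m₁ * m₂ × x ≡ m₁ * r ⁴ × y ≡ m₂ * s ⁴)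

-- Let m₁ = gcd (x , m). A common divisor i of m / m₁ and x / m₁ also divides m₁, so i² divides m
-- and i = 1. Hence m₂ = m / m₁ divides y, and the remaining quotients are coprime with product c⁴.
squareFree-split : ∀ {m} x y c → 1 ≤ m → SquareFree m → Coprime x y → x * y ≡ m * c ⁴ →
  Splitting m x y
squareFree-split {m} x y c m≥1 sf cop eq with gcd[m,n]∣m x m | gcd[m,n]∣n x m
... | divides x′ x≡ | divides m₂ m≡ = conclude (coprime-divisor m₂-x′ (divides (c ⁴) (trans cancelled (*-comm m₂ (c ⁴)))))
  where
  m₁ = gcd x m
  m₁≥1 : 1 ≤ m₁
  m₁≥1 = n≢0⇒n>0 λ e → contradiction (trans m≡ (trans (cong (m₂ *_) e) (*-zeroʳ m₂))) (m<n⇒n≢0 m≥1)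
  m₂≥1 : 1 ≤ m₂
  m₂≥1 = n≢0⇒n>0 λ e → contradiction (trans m≡ (cong (_* m₁) e)) (m<n⇒n≢0 m≥1)
  x′∣x : x′ ∣ x
  x′∣x = divides m₁ (trans x≡ (*-comm x′ m₁))
  m₂-x′ : Coprime m₂ x′
  m₂-x′ {i} (i∣m₂ , i∣x′) = sf i (subst (i * i ∣_) (sym m≡) (*-pres-∣ i∣m₂ (gcd-greatest (∣-trans i∣x′ x′∣x) (subst (i ∣_) (sym m≡) (∣m⇒∣m*n m₁ i∣m₂)))))
  cancelled : x′ * y ≡ m₂ * c ⁴
  cancelled = *-cancelʳ-≡ (x′ * y) (m₂ * c ⁴) m₁ {{>-nonZero m₁≥1}}
    (trans (i₁ x′ y m₁) (trans (cong (_* y) (sym x≡)) (trans eq (trans (cong (_* c ⁴) m≡) (i₁ m₂ m₁ (c ⁴))))))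
    where
    i₁ : ∀ x y d → x * y * d ≡ x * d * y
    i₁ = solve-∀
  conclude : m₂ ∣ y → Splitting m x y
  conclude (divides y′ y≡) = finish (coprime-fourth x′ y′ c
      (coprime-∣ x′∣x (divides m₂ (trans y≡ (*-comm y′ m₂))) cop)
      (*-cancelʳ-≡ (x′ * y′) (c ⁴) m₂ {{>-nonZero m₂≥1}}
        (trans (*-assoc x′ y′ m₂) (trans (cong (x′ *_) (sym y≡)) (trans cancelled (*-comm m₂ (c ⁴)))))))
    where
    finish : ∃[ r ] ∃[ s ] (x′ ≡ r ⁴ × y′ ≡ s ⁴) → Splitting m x y
    finish (r , s , x′≡ , y′≡) = m₁ , m₂ , r , s , trans m≡ (*-comm m₂ m₁) ,
      trans x≡ (trans (cong (_* m₁) x′≡) (*-comm (r ⁴) m₁)) , trans y≡ (trans (cong (_* m₂) y′≡) (*-comm (s ⁴) m₂))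

data Parity : ℕ → Set where
  even : ∀ t → Parity (t * 2)
  odd  : ∀ t → Parity (1 + t * 2)

parity : ∀ n → Parity n
parity zero = even 0
parity (suc n) with parity n
... | even t = odd t
... | odd  t = even (suc t)

triangular : ∀ t → ∃[ u ] (t * suc t ≡ u * 2)
triangular zero = 0 , refl
triangular (suc t) with triangular t
... | u , eq = suc (t + u) , trans (i₁ t) (trans (cong (λ w → 2 + 2 * t + w) eq) (i₂ t u))
  where
  i₁ : ∀ t → suc t * suc (suc t) ≡ 2 + 2 * t + t * suc t
  i₁ = solve-∀
  i₂ : ∀ t u → 2 + 2 * t + u * 2 ≡ suc (t + u) * 2
  i₂ = solve-∀

EvenSplit OddSplit : ℕ → ℕ → Set
EvenSplit m a = ∃[ m₁ ] ∃[ m₂ ] ∃[ r ] ∃[ s ] (m ≡ m₁ * m₂ × a * a + 1 ≡ m₁ * r ⁴ × a * a ≡ m₂ * s ⁴ + 1)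
OddSplit  m a = ∃[ m₁ ] ∃[ m₂ ] ∃[ r ] ∃[ s ] (m ≡ m₁ * m₂ × a * a + 1 ≡ 2 * (m₁ * r ⁴) × a * a ≡ 8 * (m₂ * s ⁴) + 1)

difference : ∀ {N} y → suc y ⁴ ≡ N + 1 → suc y * suc y + 1 ≡ 2 + (y * y + 2 * y) × (2 + (y * y + 2 * y)) * (y * y + 2 * y) ≡ N
difference y eq = i₁ y , +-cancelʳ-≡ 1 _ _ (trans (i₂ y) eq)
  where
  i₁ : ∀ y → suc y * suc y + 1 ≡ 2 + (y * y + 2 * y)
  i₁ = solve-∀
  i₂ : ∀ y → (2 + (y * y + 2 * y)) * (y * y + 2 * y) + 1 ≡ suc y * suc y * (suc y * suc y)
  i₂ = solve-∀

2∤1 : ¬ 2 ∣ 1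
2∤1 d = contradiction (∣1⇒≡1 d) λ ()

∣2⇒ : ∀ {i} → i ∣ 2 → i ≡ 1 ⊎ i ≡ 2
∣2⇒ {zero}              d = contradiction (0∣⇒≡0 d) λ ()
∣2⇒ {1}                 d = inj₁ refl
∣2⇒ {2}                 d = inj₂ refl
∣2⇒ {suc (suc (suc i))} d = contradiction (∣⇒≤ d) λ { (s≤s (s≤s ())) }

-- For even a the factors a² + 1 and a² - 1 are odd and differ by 2, hence are coprime.
evenSplit : ∀ {m} t b → 1 ≤ m → SquareFree m → (t * 2) ⁴ ≡ m * b ⁴ + 1 → EvenSplit m (t * 2)
evenSplit {m} zero    b m≥1 sf eq = contradiction (trans eq (+-comm _ 1)) λ ()
evenSplit {m} (suc k) b m≥1 sf eq = conclude (squareFree-split (2 + y) y b m≥1 sf cop (proj₂ facts))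
  where
  t = suc k
  y = suc (k * 2) * suc (k * 2) + 2 * suc (k * 2)
  facts = difference (suc (k * 2)) eq
  a²≡ : t * 2 * (t * 2) ≡ y + 1
  a²≡ = i k
    where
    i : ∀ k → suc k * 2 * (suc k * 2) ≡ suc (k * 2) * suc (k * 2) + 2 * suc (k * 2) + 1
    i = solve-∀
  2∤y : ¬ 2 ∣ y
  2∤y 2∣y = 2∤1 (∣m+n∣m⇒∣n (subst (2 ∣_) a²≡ (∣m⇒∣m*n (t * 2) (n∣m*n t))) 2∣y)
  cop : Coprime (2 + y) y
  cop {i} (i∣2+y , i∣y) with ∣2⇒ (∣m+n∣m⇒∣n (subst (i ∣_) (+-comm 2 y) i∣2+y) i∣y)
  ... | inj₁ i≡1 = i≡1
  ... | inj₂ refl = contradiction i∣y 2∤y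
  conclude : Splitting m (2 + y) y → EvenSplit m (t * 2)
  conclude (m₁ , m₂ , r , s , m≡ , x≡ , y≡) = m₁ , m₂ , r , s , m≡ , trans (proj₁ facts) x≡ , trans a²≡ (cong (_+ 1) y≡)

-- For odd a, a² = 8 u + 1 with u triangular, so the factors are 2 (4 u + 1) and 8 u, where 4 u + 1
-- and u are coprime. Their common 16 is absorbed by b⁴ once b is known to be even.
oddSplit : ∀ {m} t b → 1 ≤ m → m % 4 ≡ 2 ⊎ m % 4 ≡ 3 → SquareFree m → (1 + t * 2) ⁴ ≡ m * b ⁴ + 1 → OddSplit m (1 + t * 2)
oddSplit {m} t b m≥1 m%4 sf eq = split (parity b)
  where
  u = proj₁ (triangular t)
  t[1+t]≡ = proj₂ (triangular t)
  open ≡-Reasoning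
  a = 1 + t * 2
  a²≡ : a * a ≡ 8 * u + 1
  a²≡ = trans (i₁ t) (trans (cong (λ w → 4 * w + 1) t[1+t]≡) (i₂ u))
    where
    i₁ : ∀ t → (1 + t * 2) * (1 + t * 2) ≡ 4 * (t * suc t) + 1
    i₁ = solve-∀
    i₂ : ∀ u → 4 * (u * 2) + 1 ≡ 8 * u + 1
    i₂ = solve-∀
  product : 16 * ((4 * u + 1) * u) ≡ m * b ⁴
  product = +-cancelʳ-≡ 1 _ _ (trans (i u) (trans (cong (λ w → w * w) (sym a²≡)) eq))
    where
    i : ∀ u → 16 * ((4 * u + 1) * u) + 1 ≡ (8 * u + 1) * (8 * u + 1)
    i = solve-∀
  cop : Coprime (4 * u + 1) u
  cop (i∣x , i∣u) = ∣1⇒≡1 (∣m+n∣m⇒∣n i∣x (∣n⇒∣m*n 4 i∣u))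
  conclude : Splitting m (4 * u + 1) u → OddSplit m a
  conclude (m₁ , m₂ , r , s , m≡ , x≡ , y≡) = m₁ , m₂ , r , s , m≡ ,
    trans (cong (_+ 1) a²≡) (trans (i u) (cong (2 *_) x≡)) , trans a²≡ (cong (λ w → 8 * w + 1) y≡)
    where
    i : ∀ u → 8 * u + 1 + 1 ≡ 2 * (4 * u + 1)
    i = solve-∀
  split : Parity b → OddSplit m a
  split (even c) = conclude (squareFree-split (4 * u + 1) u c m≥1 sf cop (*-cancelˡ-≡ _ _ 16 (trans product (i m c))))
    where
    i : ∀ m c → m * ((c * 2) * (c * 2) * ((c * 2) * (c * 2))) ≡ 16 * (m * (c * c * (c * c)))
    i = solve-∀
  -- For odd b, b⁴ is 1 modulo 4, so 16 ∣ m b⁴ would force 4 ∣ m.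
  split (odd c) = contradiction m%4 (subst (λ k → ¬ (k ≡ 2 ⊎ k ≡ 3)) (sym (n∣m⇒m%n≡0 m 4 4∣m)) λ { (inj₁ ()) ; (inj₂ ()) })
    where
    i₁ : ∀ m c → m * ((1 + c * 2) * (1 + c * 2) * ((1 + c * 2) * (1 + c * 2)))
       ≡ 4 * (m * (2 * (c * c + c) + 4 * ((c * c + c) * (c * c + c)))) + m
    i₁ = solve-∀
    4∣m : 4 ∣ m
    4∣m = ∣m+n∣m⇒∣n (subst (4 ∣_) (trans product (i₁ m c)) (∣m⇒∣m*n ((4 * u + 1) * u) (divides 4 refl))) (m∣m*n (m * (2 * (c * c + c) + 4 * ((c * c + c) * (c * c + c)))))

-- No fourth power t ⁴ divides c with (c / t ⁴) * n < K.
noCofactor : ℕ → ℕ → ℕ → ℕ → ℕ → Bool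
noCofactorAt : ℕ → ℕ → ℕ → ℕ → ℕ → ℕ → Bool
noCofactor zero    K n c t = false
noCofactor (suc f) K n c t = noCofactorAt f K n c t (t ⁴)
noCofactorAt f K n c t t⁴ = (c <ᵇ t⁴) ∨ (not (t⁴ ∣ᵇ c) ∨ (K * t⁴ ≤ᵇ c * n)) ∧ noCofactor f K n c (suc t)

⁴-mono : ∀ {s t} → s ≤ t → s ⁴ ≤ t ⁴
⁴-mono le = *-mono-≤ (*-mono-≤ le le) (*-mono-≤ le le)

noCofactor-sound : ∀ f {K n m c t} j → 1 ≤ j → j ≤ t → 1 ≤ c → c ≡ m * t ⁴ → T (noCofactor f K n c j) → K ≤ m * n
noCofactor-sound (suc f) {K} {n} {m} {c} {t} j j≥1 j≤t c≥1 c≡ ok with T-∨⁻ {c <ᵇ j ⁴} ok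
... | inj₁ lt = contradiction (<ᵇ⇒< c (j ⁴) lt) (≤⇒≯ (≤-trans (⁴-mono j≤t) t⁴≤c))
  where
  m≥1 : 1 ≤ m
  m≥1 = n≢0⇒n>0 λ m≡0 → contradiction (trans c≡ (cong (_* t ⁴) m≡0)) (m<n⇒n≢0 c≥1)
  t⁴≤c : t ⁴ ≤ c
  t⁴≤c = ≤-trans (m≤n*m (t ⁴) m {{>-nonZero m≥1}}) (≤-reflexive (sym c≡))
... | inj₂ rest with T-∧⁻ {not (j ⁴ ∣ᵇ c) ∨ (K * j ⁴ ≤ᵇ c * n)} rest
... | here-ok , rest-ok with m≤n⇒m<n∨m≡n j≤t
... | inj₁ j<t = noCofactor-sound f {K} {n} {m} {c} {t} (suc j) (s≤s z≤n) j<t c≥1 c≡ rest-ok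
... | inj₂ refl with T-∨⁻ {not (j ⁴ ∣ᵇ c)} here-ok
... | inj₁ ∤ = contradiction (∣⇒∣ᵇ (j ⁴) c (⁴-mono j≥1) (divides m c≡)) (T-not⁻ ∤)
... | inj₂ le = *-cancelʳ-≤ K (m * n) (j ⁴) {{>-nonZero (⁴-mono j≥1)}}
    (≤-trans (≤ᵇ⇒≤ (K * j ⁴) (c * n) le) (≤-reflexive (trans (cong (_* n) c≡) (i m n (j ⁴)))))
  where
  i : ∀ m n t → m * t * n ≡ m * n * t
  i = solve-∀

hasSquareFactor : ℕ → List ℕ → Bool
hasSquareFactor m ds = any (λ d → (2 ≤ᵇ d) ∧ ((d * d) ∣ᵇ m)) ds

hasSquareFactor-sound : ∀ m ds → SquareFree m → ¬ T (hasSquareFactor m ds)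
hasSquareFactor-sound m ds sf t with satisfied (any⁻ (λ d → (2 ≤ᵇ d) ∧ ((d * d) ∣ᵇ m)) ds t)
... | d , t′ with T-∧⁻ {2 ≤ᵇ d} t′
... | d≥2 , dd∣m = <⇒≢ (≤ᵇ⇒≤ 2 d d≥2) (sym (sf d (∣ᵇ⇒∣ (d * d) m dd∣m)))

-- With x = a, the sign tells which factor of m is n. For true, n = m₂ and the cofactor m₁ is sought
-- in a² + 1; for false, n = m₁ and m₂ is sought in a² - 1. The radicand is n for even a and 2 n for
-- odd a, and z is r² or s², except for odd a and true, where it is 2 s². The search for fourth
-- powers is left for last, as it is hopeless for huge x.
evenTest oddTest : ℕ → ℕ → Bool → ℕ → ℕ → Bool
evenTest K n true  x z = (x ≤ᵇ 500) ∨ nonSquare z ∨ noCofactor 100000 K n (x * x + 1) 1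
evenTest K n false x z = (x ≤ᵇ 500) ∨ nonSquare z ∨ noCofactor 100000 K n (x * x ∸ 1) 1
oddTest  K n true  x z = (x ≤ᵇ 500) ∨ nonSquare (z / 2) ∨ noCofactor 100000 K n ((x * x + 1) / 2) 1
oddTest  K n false x z = (x ≤ᵇ 500) ∨ nonSquare z ∨ noCofactor 100000 K n ((x * x ∸ 1) / 8) 1

-- A square radicand has no Pell solution with x > 1, and no continued fraction.
settledAt : (Bool → ℕ → ℕ → Bool) → ℕ → ℕ → ℕ → Bool
settledAt t B D S = (S * S ≡ᵇ D) ∨ allSolutions 6000 t B D S

-- For even a both factors of m are odd, so an even n needs only the test for odd a. A divisor n of
-- m has no square factor.
settledPositive : ℕ → ℕ → ℕ → Bool
settledPositive K B n = hasSquareFactor n (2 ∷ 3 ∷ 5 ∷ 7 ∷ []) ∨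
  ((2 ∣ᵇ n) ∨ settledAt (evenTest K n) B n (isqrt n)) ∧ settledAt (oddTest K n) B (2 * n) (isqrt (2 * n))

abstract
  settledPositive-ok : Verified (allBelow 3163 (settledPositive (10 ^ 7) (10 ^ 500)))
  settledPositive-ok = verified refl

-- Squares lying 1 apart are 0 and 1: (w + 1)² already exceeds w² by 2 w + 1.
pell-square : ∀ σ S x z → Pell σ (S * S) x z → x ≤ 1
pell-square σ S x z pell with <-cmp x (S * z) | trans pell (cong (_+ plus σ) (interchange S z))
... | tri≈ _ refl _ | eq = contradiction (+-cancelˡ-≡ (x * x) _ _ eq) (not-≡ σ)
  where
  not-≡ : ∀ σ → plus (not σ) ≢ plus σ
  not-≡ true ()
  not-≡ false ()
... | tri< x<w _ _ | eq = s≤s⁻¹ (≤-trans (+-cancelˡ-≤ (x * x) (suc x) 1 (begin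
    x * x + suc x                     ≤⟨ m≤m+n _ x ⟩
    x * x + suc x + x                 ≡⟨ i x ⟩
    suc x * suc x                     ≤⟨ *-mono-≤ x<w x<w ⟩
    (S * z) * (S * z)                 ≤⟨ m≤m+n _ (plus σ) ⟩
    (S * z) * (S * z) + plus σ        ≡⟨ eq ⟨
    x * x + plus (not σ)              ≤⟨ +-monoʳ-≤ (x * x) (plus≤1 (not σ)) ⟩
    x * x + 1                         ∎)) (s≤s z≤n))
  where
  open ≤-Reasoning
  i : ∀ x → x * x + suc x + x ≡ suc x * suc x
  i = solve-∀
... | tri> _ _ w<x | eq = +-cancelˡ-≤ (w * w + w) x 1 bound
  where
  open ≤-Reasoning
  w = S * z
  bound : w * w + w + x ≤ w * w + w + 1
  bound = begin
    w * w + w + x          ≤⟨ +-monoˡ-≤ x (≤-reflexive (+-comm (w * w) w)) ⟩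
    suc w * w + x          ≤⟨ +-monoˡ-≤ x (*-monoˡ-≤ w w<x) ⟩
    x * w + x              ≡⟨ trans (+-comm (x * w) x) (sym (*-suc x w)) ⟩
    x * suc w              ≤⟨ *-monoʳ-≤ x w<x ⟩
    x * x                  ≤⟨ m≤m+n _ (plus (not σ)) ⟩
    x * x + plus (not σ)   ≡⟨ eq ⟩
    w * w + plus σ         ≤⟨ +-mono-≤ (m≤m+n (w * w) w) (plus≤1 σ) ⟩
    w * w + w + 1          ∎

settledAt-sound : ∀ t B D S → T (settledAt t B D S) → ∀ σ x z → Pell σ D x z → x < B → x ≤ 1 ⊎ T (t σ x z)
settledAt-sound t B D S ok σ x z pell lt with T-∨⁻ {S * S ≡ᵇ D} ok
... | inj₁ sq = inj₁ (pell-square σ S x z (subst (λ D → Pell σ D x z) (sym (≡ᵇ⇒≡ (S * S) D sq)) pell))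
... | inj₂ sols = inj₂ (allSolutions-sound 6000 t B D S sols σ x z pell lt)

testShape-sound : ∀ {K n x z w c m′ t} f → x ≤ 1 ⊎ T ((x ≤ᵇ 500) ∨ nonSquare z ∨ noCofactor f K n c 1) →
  z ≡ w * w → c ≡ m′ * t ⁴ → 1 ≤ c → m′ * n < K → x ≤ 500
testShape-sound f (inj₁ le) _ _ _ _ = ≤-trans le (s≤s z≤n)
testShape-sound {K} {n} {x} {z} {w} {c} {m′} {t} f (inj₂ ok) z≡ c≡ c≥1 lt with T-∨⁻ {x ≤ᵇ 500} ok
... | inj₁ le = ≤ᵇ⇒≤ x 500 le
... | inj₂ ok′ with T-∨⁻ {nonSquare z} ok′
... | inj₁ ns = contradiction z≡ (nonSquare-sound z w ns)
... | inj₂ nc = contradiction (noCofactor-sound f {K} {n} {m′} {c} {t} 1 (s≤s z≤n) t≥1 c≥1 c≡ nc) (<⇒≱ lt)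
  where
  t≥1 : 1 ≤ t
  t≥1 = n≢0⇒n>0 λ t≡0 → contradiction (trans c≡ (trans (cong (λ t → m′ * t ⁴) t≡0) (*-zeroʳ m′))) (m<n⇒n≢0 c≥1)

record SmallCofactor (m n m′ : ℕ) : Set where
  constructor smallCofactor
  field
    n<3163     : n < 3163
    squareFree : SquareFree n
    product    : m′ * n ≡ m

divisor-squareFree : ∀ {m n} → n ∣ m → SquareFree m → SquareFree n
divisor-squareFree n∣m sf d dd∣n = sf d (∣-trans dd∣n n∣m)

smallFactor : ∀ {m} m₁ m₂ → m < 10 ^ 7 → SquareFree m → m ≡ m₁ * m₂ →
  SmallCofactor m m₁ m₂ ⊎ SmallCofactor m m₂ m₁
smallFactor {m} m₁ m₂ lt sf m≡ with m₁ <? 3163 | m₂ <? 3163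
... | yes small | _         = inj₁ (smallCofactor small (divisor-squareFree (divides m₂ (trans m≡ (*-comm m₁ m₂))) sf) (trans (*-comm m₂ m₁) (sym m≡)))
... | no _      | yes small = inj₂ (smallCofactor small (divisor-squareFree (divides m₁ m≡) sf) (sym m≡))
... | no big₁   | no big₂   = contradiction (≤-<-trans (≤ᵇ⇒≤ (10 ^ 7) (3163 * 3163) tt) (≤-<-trans (*-mono-≤ (≮⇒≥ big₁) (≮⇒≥ big₂)) (≤-<-trans (≤-reflexive (sym m≡)) lt))) (<-irrefl refl)

settledTests : ∀ {m n m′} → SmallCofactor m n m′ →
  ((2 ∣ n) ⊎ T (settledAt (evenTest (10 ^ 7) n) (10 ^ 500) n (isqrt n))) × T (settledAt (oddTest (10 ^ 7) n) (10 ^ 500) (2 * n) (isqrt (2 * n)))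
settledTests {n = n} (smallCofactor n<3163 sf _) = conclude (T-∨⁻ {hasSquareFactor n ds} (verified-below 3163 (settledPositive (10 ^ 7) (10 ^ 500)) settledPositive-ok n<3163))
  where
  ds = 2 ∷ 3 ∷ 5 ∷ 7 ∷ []
  E = settledAt (evenTest (10 ^ 7) n) (10 ^ 500) n (isqrt n)
  O = settledAt (oddTest (10 ^ 7) n) (10 ^ 500) (2 * n) (isqrt (2 * n))
  even-case : T (2 ∣ᵇ n) ⊎ T E → 2 ∣ n ⊎ T E
  even-case (inj₁ d) = inj₁ (∣ᵇ⇒∣ 2 n d)
  even-case (inj₂ t) = inj₂ t
  conclude : T (hasSquareFactor n ds) ⊎ T (((2 ∣ᵇ n) ∨ E) ∧ O) → (2 ∣ n ⊎ T E) × T O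
  conclude (inj₁ sq) = contradiction sq (hasSquareFactor-sound n ds sf)
  conclude (inj₂ t)  = even-case (T-∨⁻ {2 ∣ᵇ n} (proj₁ (T-∧⁻ {(2 ∣ᵇ n) ∨ E} t))) , proj₂ (T-∧⁻ {(2 ∣ᵇ n) ∨ E} t)

evenSettled : ∀ {m n m′} → SmallCofactor m n m′ → ¬ 2 ∣ n → ∀ σ x z → Pell σ n x z → x < 10 ^ 500 →
  x ≤ 1 ⊎ T (evenTest (10 ^ 7) n σ x z)
evenSettled {n = n} sc 2∤n = conclude (proj₁ (settledTests sc))
  where
  conclude : (2 ∣ n) ⊎ T (settledAt (evenTest (10 ^ 7) n) (10 ^ 500) n (isqrt n)) → ∀ σ x z → Pell σ n x z → x < 10 ^ 500 →
    x ≤ 1 ⊎ T (evenTest (10 ^ 7) n σ x z)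
  conclude (inj₁ 2∣n) = contradiction 2∣n 2∤n
  conclude (inj₂ t)   = settledAt-sound (evenTest (10 ^ 7) n) (10 ^ 500) n (isqrt n) t

oddSettled : ∀ {m n m′} → SmallCofactor m n m′ → ∀ σ x z → Pell σ (2 * n) x z → x < 10 ^ 500 →
  x ≤ 1 ⊎ T (oddTest (10 ^ 7) n σ x z)
oddSettled {n = n} sc = settledAt-sound (oddTest (10 ^ 7) n) (10 ^ 500) (2 * n) (isqrt (2 * n)) (proj₂ (settledTests sc))

pred-≥1 : ∀ {a} → 501 ≤ a → 1 ≤ a * a ∸ 1
pred-≥1 {a} le = ∸-monoˡ-≤ {2} {a * a} 1 (≤-trans (≤ᵇ⇒≤ 2 (501 * 501) tt) (*-mono-≤ le le))

even-small : ∀ {m a} → m < 10 ^ 7 → SquareFree m → 2 ∣ a → a < 10 ^ 500 → 501 ≤ a → EvenSplit m a → a ≤ 500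
even-small {m} {a} m< sf 2∣a a< large (m₁ , m₂ , r , s , m≡ , x≡ , y≡) = conclude (smallFactor m₁ m₂ m< sf m≡)
  where
  c≡ : a * a ∸ 1 ≡ m₂ * s ⁴
  c≡ = trans (cong (_∸ 1) y≡) (m+n∸n≡m (m₂ * s ⁴) 1)
  2∣a² : 2 ∣ a * a
  2∣a² = ∣m⇒∣m*n a 2∣a
  2∤m₁ : ¬ 2 ∣ m₁
  2∤m₁ d = 2∤1 (∣m+n∣m⇒∣n (subst (2 ∣_) (sym x≡) (∣m⇒∣m*n (r ⁴) d)) 2∣a²)
  2∤m₂ : ¬ 2 ∣ m₂
  2∤m₂ d = 2∤1 (∣m+n∣m⇒∣n (subst (2 ∣_) y≡ 2∣a²) (∣m⇒∣m*n (s ⁴) d))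
  conclude : SmallCofactor m m₁ m₂ ⊎ SmallCofactor m m₂ m₁ → a ≤ 500
  conclude (inj₁ sc@(smallCofactor _ _ prod)) = testShape-sound {10 ^ 7} {m₁} {a} {r * r} {r} {a * a ∸ 1} {m₂} {s} 100000
    (evenSettled sc 2∤m₁ false a (r * r) (trans x≡ (sym (+-identityʳ _))) a<)
    refl c≡ (pred-≥1 large) (≤-<-trans (≤-reflexive prod) m<)
  conclude (inj₂ sc@(smallCofactor _ _ prod)) = testShape-sound {10 ^ 7} {m₂} {a} {s * s} {s} {a * a + 1} {m₁} {r} 100000
    (evenSettled sc 2∤m₂ true a (s * s) (trans (+-identityʳ _) y≡) a<)
    refl x≡ (m≤n+m 1 (a * a)) (≤-<-trans (≤-reflexive prod) m<)

odd-small : ∀ {m a} → m < 10 ^ 7 → SquareFree m → a < 10 ^ 500 → 501 ≤ a → OddSplit m a → a ≤ 500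
odd-small {m} {a} m< sf a< large (m₁ , m₂ , r , s , m≡ , x≡ , y≡) = conclude (smallFactor m₁ m₂ m< sf m≡)
  where
  x/2≡ : (a * a + 1) / 2 ≡ m₁ * r ⁴
  x/2≡ = trans (cong (_/ 2) (trans x≡ (*-comm 2 (m₁ * r ⁴)))) (m*n/n≡m (m₁ * r ⁴) 2)
  y/8≡ : (a * a ∸ 1) / 8 ≡ m₂ * s ⁴
  y/8≡ = trans (cong (_/ 8) (trans (cong (_∸ 1) y≡) (trans (m+n∸n≡m (8 * (m₂ * s ⁴)) 1) (*-comm 8 (m₂ * s ⁴))))) (m*n/n≡m (m₂ * s ⁴) 8)
  x/2≥1 : 1 ≤ (a * a + 1) / 2
  x/2≥1 = m≥n⇒m/n>0 (+-monoˡ-≤ 1 (*-mono-≤ (≤-trans (s≤s z≤n) large) (≤-trans (s≤s z≤n) large)))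
  y/8≥1 : 1 ≤ (a * a ∸ 1) / 8
  y/8≥1 = m≥n⇒m/n>0 (∸-monoˡ-≤ {9} {a * a} 1 (≤-trans (≤ᵇ⇒≤ 9 (501 * 501) tt) (*-mono-≤ large large)))
  i₁ : ∀ m r → 2 * (m * (r * r * (r * r))) ≡ 2 * m * (r * r * (r * r)) + 0
  i₁ = solve-∀
  -- From 8 s⁴ = 2 (2 s²)²: the radicand is 2 m₂ and the second Pell coordinate 2 s², which
  -- `oddTest` halves.
  i₂ : ∀ m s → 8 * (m * (s * s * (s * s))) + 1 ≡ 2 * m * (s * s * 2 * (s * s * 2)) + 1
  i₂ = solve-∀
  conclude : SmallCofactor m m₁ m₂ ⊎ SmallCofactor m m₂ m₁ → a ≤ 500
  conclude (inj₁ sc@(smallCofactor _ _ prod)) = testShape-sound {10 ^ 7} {m₁} {a} {r * r} {r} {(a * a ∸ 1) / 8} {m₂} {s} 100000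
    (oddSettled sc false a (r * r) (trans x≡ (i₁ m₁ r)) a<)
    refl y/8≡ y/8≥1 (≤-<-trans (≤-reflexive prod) m<)
  conclude (inj₂ sc@(smallCofactor _ _ prod)) = testShape-sound {10 ^ 7} {m₂} {a} {s * s * 2 / 2} {s} {(a * a + 1) / 2} {m₁} {r} 100000
    (oddSettled sc true a (s * s * 2) (trans (+-identityʳ _) (trans y≡ (i₂ m₂ s))) a<)
    (m*n/n≡m (s * s) 2) x/2≡ x/2≥1 (≤-<-trans (≤-reflexive prod) m<)

-- The factored equations have a itself as first Pell coordinate, where the equation for -1 has a²;
-- so the range to search is only 10⁵⁰⁰.
root-bound : ∀ a → a * a < 10 ^ 1000 → a < 10 ^ 500
root-bound a lt = ≰⇒> λ le → contradiction (*-mono-≤ le le) (<⇒≱ (<-≤-trans lt (≤-reflexive (^-distribˡ-+-* 10 500 500))))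

positive-small : ∀ m a b → 1 ≤ m → m < 10 ^ 7 → SquareFree m → m % 4 ≡ 2 ⊎ m % 4 ≡ 3 → a ⁴ ≡ m * b ⁴ + 1 → a * a < 10 ^ 1000 → a ≤ 500
positive-small m a b m≥1 m< sf m%4 eq lt with a ≤? 500
... | yes le = le
... | no nle = conclude (parity a) eq lt (≰⇒> nle)
  where
  conclude : ∀ {a} → Parity a → a ⁴ ≡ m * b ⁴ + 1 → a * a < 10 ^ 1000 → 501 ≤ a → a ≤ 500
  conclude (even t) eq lt large = even-small m< sf (n∣m*n t) (root-bound (t * 2) lt) large (evenSplit t b m≥1 sf eq)
  conclude (odd t)  eq lt large = odd-small m< sf (root-bound (1 + t * 2) lt) large (oddSplit t b m≥1 m%4 sf eq)

-- Solutions with a ≤ 500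

entryTest : ℕ → ℕ → ℕ → ℕ × ℤ × ℤ × ℤ → Bool
entryTest m a b (m′ , + x , + y , + z) = (m ≡ᵇ m′) ∧ (a * a ≡ᵇ x) ∧ (a * b ≡ᵇ y) ∧ (b * b ≡ᵇ z)
entryTest m a b _                      = false

entryTest-sound : ∀ m a b e → T (entryTest m a b e) → (m , + (a * a) , + (a * b) , + (b * b)) ≡ e
entryTest-sound m a b (m′ , + x , + y , + z) t with T-∧⁻ {m ≡ᵇ m′} t
... | t₁ , t′ with T-∧⁻ {a * a ≡ᵇ x} t′
... | t₂ , t″ with T-∧⁻ {a * b ≡ᵇ y} t″
... | t₃ , t₄ rewrite ≡ᵇ⇒≡ m m′ t₁ | ≡ᵇ⇒≡ (a * a) x t₂ | ≡ᵇ⇒≡ (a * b) y t₃ | ≡ᵇ⇒≡ (b * b) z t₄ = refl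

-- The factor 2 is left to the condition modulo 4. The primes up to 41 suffice to reject every
-- quotient in the search that is unlisted and meets the other conditions.
squareFactors : List ℕ
squareFactors = 3 ∷ 5 ∷ 7 ∷ 11 ∷ 13 ∷ 17 ∷ 19 ∷ 23 ∷ 29 ∷ 31 ∷ 37 ∷ 41 ∷ []

listedOrExcluded : ℕ → ℕ → ℕ → Bool
listedOrExcluded m a b = (m ≤ᵇ 1) ∨ (10 ^ 7 ≤ᵇ m) ∨ (m % 4 ≤ᵇ 1) ∨
  hasSquareFactor m squareFactors ∨ any (entryTest m a b) table

floorDiv : ℕ → ℕ → ℕ
floorDiv N zero    = 0
floorDiv N (suc k) = N / suc k

pairTest : ℕ → ℕ → ℕ → ℕ → Bool
pairTest a b b⁴ N = not (b⁴ ∣ᵇ N) ∨ listedOrExcluded (floorDiv N b⁴) a b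

smallAt : ℕ → ℕ → Bool
smallAt a a⁴ = allBelow a λ j → pairTest a (suc j) (suc j ⁴) (a⁴ + 1) ∧ pairTest a (suc j) (suc j ⁴) (a⁴ ∸ 1)

smallTest : ℕ → Bool
smallTest i = smallAt (suc i) (suc i ⁴)

abstract
  smallTest-ok : Verified (allBelow 500 smallTest)
  smallTest-ok = verified refl

record Admissible (m : ℕ) : Set where
  constructor admissible
  field
    m>1        : 1 < m
    m<10⁷      : m < 10 ^ 7
    squareFree : SquareFree m
    m%4        : m % 4 ≡ 2 ⊎ m % 4 ≡ 3

listedOrExcluded-sound : ∀ {m} a b → Admissible m → T (listedOrExcluded m a b) → (m , + (a * a) , + (a * b) , + (b * b)) ∈ table
listedOrExcluded-sound {m} a b (admissible m>1 m< sf m%4) t with T-∨⁻ {m ≤ᵇ 1} t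
... | inj₁ e = contradiction (≤ᵇ⇒≤ m 1 e) (<⇒≱ m>1)
... | inj₂ t₁ with T-∨⁻ {10 ^ 7 ≤ᵇ m} t₁
... | inj₁ e = contradiction (≤ᵇ⇒≤ (10 ^ 7) m e) (<⇒≱ m<)
... | inj₂ t₂ with T-∨⁻ {m % 4 ≤ᵇ 1} t₂
... | inj₁ e = contradiction (≤ᵇ⇒≤ (m % 4) 1 e) (≰1 m%4)
... | inj₂ t₃ with T-∨⁻ {hasSquareFactor m squareFactors} t₃
... | inj₁ e = contradiction e (hasSquareFactor-sound m squareFactors sf)
... | inj₂ e = Any.map (λ {e} → entryTest-sound m a b e) (any⁻ (entryTest m a b) table e)

pairTest-sound : ∀ {m} a b N → Admissible m → N ≡ m * b ⁴ → 1 ≤ b → T (pairTest a b (b ⁴) N) →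
  (m , + (a * a) , + (a * b) , + (b * b)) ∈ table
pairTest-sound {m} a b N adm N≡ b≥1 t with T-∨⁻ {not (b ⁴ ∣ᵇ N)} t
... | inj₁ ∤ = contradiction (∣⇒∣ᵇ (b ⁴) N (⁴-mono b≥1) (divides m N≡)) (T-not⁻ ∤)
... | inj₂ ok = listedOrExcluded-sound a b adm (subst (λ q → T (listedOrExcluded q a b)) (exact (b ⁴) (⁴-mono b≥1) N≡) ok)
  where
  exact : ∀ d → 1 ≤ d → N ≡ m * d → floorDiv N d ≡ m
  exact (suc k) _ refl = m*n/n≡m m (suc k)

QuarticSolution : ℕ → ℕ → ℕ → Set
QuarticSolution m a b = a ⁴ + 1 ≡ m * b ⁴ ⊎ a ⁴ ≡ m * b ⁴ + 1

-- Otherwise a⁴ + 1 ≤ b⁴ < m b⁴, which contradicts either sign. This bounds the search over b.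
b≤a : ∀ {m a b} → 1 < m → 1 ≤ b → QuarticSolution m a b → b ≤ a
b≤a {m} {a} {b} m>1 b≥1 sol = ≮⇒≥ λ a<b → impossible (≤-trans (i a) (⁴-mono a<b)) sol
  where
  open ≤-Reasoning
  i : ∀ a → suc (a ⁴) ≤ suc a ⁴
  i a = begin
    suc (a ⁴)      ≤⟨ m≤m+n (suc (a ⁴)) _ ⟩
    suc (a * a * (a * a)) + (4 * (a * a * a) + 6 * (a * a) + 4 * a)  ≡⟨ j a ⟩
    suc a ⁴        ∎
    where
    j : ∀ a → suc (a * a * (a * a)) + (4 * (a * a * a) + 6 * (a * a) + 4 * a) ≡ suc a * suc a * (suc a * suc a)
    j = solve-∀
  double : b ⁴ < m * b ⁴
  double = <-≤-trans (m<m*n (b ⁴) m {{>-nonZero (⁴-mono b≥1)}} m>1) (≤-reflexive (*-comm (b ⁴) m))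
  impossible : suc (a ⁴) ≤ b ⁴ → ¬ QuarticSolution m a b
  impossible lt (inj₁ eq) = <-irrefl refl (begin-strict
    m * b ⁴     ≡⟨ eq ⟨
    a ⁴ + 1     ≡⟨ +-comm (a ⁴) 1 ⟩
    suc (a ⁴)   ≤⟨ lt ⟩
    b ⁴         <⟨ double ⟩
    m * b ⁴     ∎)
  impossible lt (inj₂ eq) = <-irrefl refl (begin-strict
    a ⁴         <⟨ lt ⟩
    b ⁴         <⟨ double ⟩
    m * b ⁴     ≤⟨ m≤m+n _ 1 ⟩
    m * b ⁴ + 1 ≡⟨ eq ⟨
    a ⁴         ∎)

small-listed : ∀ {m} a b → Admissible m → 1 ≤ b → QuarticSolution m a b → a ≤ 500 →
  (m , + (a * a) , + (a * b) , + (b * b)) ∈ table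
small-listed {m} a@(suc i) b@(suc j) adm b≥1 sol a≤500 = choose sol (T-∧⁻ {pairTest a b (b ⁴) (a ⁴ + 1)} both)
  where
  pairs : ℕ → Bool
  pairs j = pairTest a (suc j) (suc j ⁴) (a ⁴ + 1) ∧ pairTest a (suc j) (suc j ⁴) (a ⁴ ∸ 1)
  both : T (pairTest a b (b ⁴) (a ⁴ + 1) ∧ pairTest a b (b ⁴) (a ⁴ ∸ 1))
  both = allBelow-sound a pairs (verified-below 500 smallTest smallTest-ok a≤500) (b≤a {a = a} (Admissible.m>1 adm) b≥1 sol)
  choose : QuarticSolution m a b → T (pairTest a b (b ⁴) (a ⁴ + 1)) × T (pairTest a b (b ⁴) (a ⁴ ∸ 1)) →
    (m , + (a * a) , + (a * b) , + (b * b)) ∈ table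
  choose (inj₁ eq) (t , _) = pairTest-sound a b (a ⁴ + 1) adm eq b≥1 t
  choose (inj₂ eq) (_ , t) = pairTest-sound a b (a ⁴ ∸ 1) adm (trans (cong (_∸ 1) eq) (m+n∸n≡m (m * b ⁴) 1)) b≥1 t
small-listed zero (suc j) adm b≥1 sol a≤500 = contradiction (b≤a {a = 0} (Admissible.m>1 adm) b≥1 sol) λ ()

quartic-listed : ∀ {m} a b → Admissible m → 1 ≤ b → QuarticSolution m a b → a * a < 10 ^ 1000 →
  (m , + (a * a) , + (a * b) , + (b * b)) ∈ table
quartic-listed {m} a b adm b≥1 sol lt = small-listed a b adm b≥1 sol (bound sol)
  where
  open Admissible adm
  bound : QuarticSolution m a b → a ≤ 500
  bound (inj₁ eq) = negative-small m a b m<10⁷ m%4 eq lt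
  bound (inj₂ eq) = positive-small m a b (<⇒≤ m>1) m<10⁷ squareFree m%4 eq lt

-- The index form

det : El → El → El → ℤ
det a b c =
  c1 a *ᶻ (c2 b *ᶻ c3 c -ᶻ c3 b *ᶻ c2 c) +ᶻ c2 a *ᶻ (c3 b *ᶻ c1 c -ᶻ c1 b *ᶻ c3 c) +ᶻ c3 a *ᶻ (c1 b *ᶻ c2 c -ᶻ c2 b *ᶻ c1 c)

det-* : ∀ u₁ u₂ u₃ v₁ v₂ v₃ w₁ w₂ w₃ a₁ a₂ a₃ b₁ b₂ b₃ e₁ e₂ e₃ →
  (u₁ *ᶻ (v₂ *ᶻ w₃ -ᶻ v₃ *ᶻ w₂) +ᶻ u₂ *ᶻ (v₃ *ᶻ w₁ -ᶻ v₁ *ᶻ w₃) +ᶻ u₃ *ᶻ (v₁ *ᶻ w₂ -ᶻ v₂ *ᶻ w₁)) *ᶻ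
  (a₁ *ᶻ (b₂ *ᶻ e₃ -ᶻ b₃ *ᶻ e₂) +ᶻ a₂ *ᶻ (b₃ *ᶻ e₁ -ᶻ b₁ *ᶻ e₃) +ᶻ a₃ *ᶻ (b₁ *ᶻ e₂ -ᶻ b₂ *ᶻ e₁)) ≡
  (u₁ *ᶻ a₁ +ᶻ (u₂ *ᶻ b₁ +ᶻ u₃ *ᶻ e₁)) *ᶻ ((v₁ *ᶻ a₂ +ᶻ (v₂ *ᶻ b₂ +ᶻ v₃ *ᶻ e₂)) *ᶻ (w₁ *ᶻ a₃ +ᶻ (w₂ *ᶻ b₃ +ᶻ w₃ *ᶻ e₃)) -ᶻ (v₁ *ᶻ a₃ +ᶻ (v₂ *ᶻ b₃ +ᶻ v₃ *ᶻ e₃)) *ᶻ (w₁ *ᶻ a₂ +ᶻ (w₂ *ᶻ b₂ +ᶻ w₃ *ᶻ e₂))) +ᶻ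
  (u₁ *ᶻ a₂ +ᶻ (u₂ *ᶻ b₂ +ᶻ u₃ *ᶻ e₂)) *ᶻ ((v₁ *ᶻ a₃ +ᶻ (v₂ *ᶻ b₃ +ᶻ v₃ *ᶻ e₃)) *ᶻ (w₁ *ᶻ a₁ +ᶻ (w₂ *ᶻ b₁ +ᶻ w₃ *ᶻ e₁)) -ᶻ (v₁ *ᶻ a₁ +ᶻ (v₂ *ᶻ b₁ +ᶻ v₃ *ᶻ e₁)) *ᶻ (w₁ *ᶻ a₃ +ᶻ (w₂ *ᶻ b₃ +ᶻ w₃ *ᶻ e₃))) +ᶻ
  (u₁ *ᶻ a₃ +ᶻ (u₂ *ᶻ b₃ +ᶻ u₃ *ᶻ e₃)) *ᶻ ((v₁ *ᶻ a₁ +ᶻ (v₂ *ᶻ b₁ +ᶻ v₃ *ᶻ e₁)) *ᶻ (w₁ *ᶻ a₂ +ᶻ (w₂ *ᶻ b₂ +ᶻ w₃ *ᶻ e₂)) -ᶻ (v₁ *ᶻ a₂ +ᶻ (v₂ *ᶻ b₂ +ᶻ v₃ *ᶻ e₂)) *ᶻ (w₁ *ᶻ a₁ +ᶻ (w₂ *ᶻ b₁ +ᶻ w₃ *ᶻ e₁)))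
det-* = solveℤ-∀

El-≡ : ∀ {u v} → c0 u ≡ c0 v → c1 u ≡ c1 v → c2 u ≡ c2 v → c3 u ≡ c3 v → u ≡ v
El-≡ {⟨ _ , _ , _ , _ ⟩} {⟨ _ , _ , _ , _ ⟩} refl refl refl refl = refl

combine-0 : ∀ k₀ k₁ k₂ k₃ a₁ a₂ a₃ → k₀ *ᶻ + 0 +ᶻ (k₁ *ᶻ a₁ +ᶻ (k₂ *ᶻ a₂ +ᶻ k₃ *ᶻ a₃)) ≡ k₁ *ᶻ a₁ +ᶻ (k₂ *ᶻ a₂ +ᶻ k₃ *ᶻ a₃)
combine-0 = solveℤ-∀

det-identity : ∀ {p₁ p₂ p₃ q₁ q₂ q₃ r₁ r₂ r₃} → p₁ ≡ + 1 → p₂ ≡ + 0 → p₃ ≡ + 0 → q₁ ≡ + 0 → q₂ ≡ + 1 → q₃ ≡ + 0 →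
  r₁ ≡ + 0 → r₂ ≡ + 0 → r₃ ≡ + 1 → p₁ *ᶻ (q₂ *ᶻ r₃ -ᶻ q₃ *ᶻ r₂) +ᶻ p₂ *ᶻ (q₃ *ᶻ r₁ -ᶻ q₁ *ᶻ r₃) +ᶻ p₃ *ᶻ (q₁ *ᶻ r₂ -ᶻ q₂ *ᶻ r₁) ≡ + 1
det-identity refl refl refl refl refl refl refl refl refl = refl

unit-factor : ∀ i j → i *ᶻ j ≡ + 1 → ∣ j ∣ ≡ 1
unit-factor i j eq = m*n≡1⇒n≡1 ∣ i ∣ ∣ j ∣ (trans (sym (ℤP.abs-* i j)) (cong ∣_∣ eq))

-- Express α, α², α³ through b. As b₀ = 1 does not touch the last three coordinates, the 3 × 3
-- matrix of the other coefficients times that of b₁, b₂, b₃ is the identity.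
spanning⇒unit : ∀ (b : Fin 4 → El) → b zero ≡ oneE → (∀ v → ∃[ c ] (linComb c b ≡ v)) →
  ∣ det (b (suc zero)) (b (suc (suc zero))) (b (suc (suc (suc zero)))) ∣ ≡ 1
spanning⇒unit b b₀≡1 span = unit-factor (U 1F *ᶻ (V 2F *ᶻ W 3F -ᶻ V 3F *ᶻ W 2F) +ᶻ U 2F *ᶻ (V 3F *ᶻ W 1F -ᶻ V 1F *ᶻ W 3F) +ᶻ U 3F *ᶻ (V 1F *ᶻ W 2F -ᶻ V 2F *ᶻ W 1F)) (det β₁ β₂ β₃)
  (trans (det-* (U 1F) (U 2F) (U 3F) (V 1F) (V 2F) (V 3F) (W 1F) (W 2F) (W 3F)
      (c1 β₁) (c2 β₁) (c3 β₁) (c1 β₂) (c2 β₂) (c3 β₂) (c1 β₃) (c2 β₃) (c3 β₃))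
    (det-identity (row U c1 refl (cong c1 U≡)) (row U c2 refl (cong c2 U≡)) (row U c3 refl (cong c3 U≡))
                  (row V c1 refl (cong c1 V≡)) (row V c2 refl (cong c2 V≡)) (row V c3 refl (cong c3 V≡))
                  (row W c1 refl (cong c1 W≡)) (row W c2 refl (cong c2 W≡)) (row W c3 refl (cong c3 W≡))))
  where
  1F 2F 3F : Fin 4
  1F = suc zero
  2F = suc (suc zero)
  3F = suc (suc (suc zero))
  β₁ = b 1F
  β₂ = b 2F
  β₃ = b 3F
  U V W : Fin 4 → ℤ
  U = proj₁ (span ⟨ + 0 , + 1 , + 0 , + 0 ⟩)
  V = proj₁ (span ⟨ + 0 , + 0 , + 1 , + 0 ⟩)
  W = proj₁ (span ⟨ + 0 , + 0 , + 0 , + 1 ⟩)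
  U≡ = proj₂ (span ⟨ + 0 , + 1 , + 0 , + 0 ⟩)
  V≡ = proj₂ (span ⟨ + 0 , + 0 , + 1 , + 0 ⟩)
  W≡ = proj₂ (span ⟨ + 0 , + 0 , + 0 , + 1 ⟩)
  row : ∀ (k : Fin 4 → ℤ) (c : El → ℤ) {w} → c oneE ≡ + 0 →
    k zero *ᶻ c (b zero) +ᶻ (k 1F *ᶻ c β₁ +ᶻ (k 2F *ᶻ c β₂ +ᶻ k 3F *ᶻ c β₃)) ≡ w →
    k 1F *ᶻ c β₁ +ᶻ (k 2F *ᶻ c β₂ +ᶻ k 3F *ᶻ c β₃) ≡ w
  row k c c1≡0 eq = trans (sym (combine-0 (k zero) (k 1F) (k 2F) (k 3F) (c β₁) (c β₂) (c β₃)))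
    (trans (cong (λ t → k zero *ᶻ t +ᶻ (k 1F *ᶻ c β₁ +ᶻ (k 2F *ᶻ c β₂ +ᶻ k 3F *ᶻ c β₃))) (trans (sym c1≡0) (cong c (sym b₀≡1)))) eq)

-- Cramer's rule with a factor d, later the determinant itself: since d d = 1, multiplying by d
-- replaces dividing by it.
cramer₁ : ∀ d v₁ v₂ v₃ a₁ a₂ a₃ b₁ b₂ b₃ e₁ e₂ e₃ →
  d *ᶻ (v₁ *ᶻ (b₂ *ᶻ e₃ -ᶻ b₃ *ᶻ e₂) +ᶻ v₂ *ᶻ (b₃ *ᶻ e₁ -ᶻ b₁ *ᶻ e₃) +ᶻ v₃ *ᶻ (b₁ *ᶻ e₂ -ᶻ b₂ *ᶻ e₁)) *ᶻ a₁ +ᶻ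
  (d *ᶻ (a₁ *ᶻ (v₂ *ᶻ e₃ -ᶻ v₃ *ᶻ e₂) +ᶻ a₂ *ᶻ (v₃ *ᶻ e₁ -ᶻ v₁ *ᶻ e₃) +ᶻ a₃ *ᶻ (v₁ *ᶻ e₂ -ᶻ v₂ *ᶻ e₁)) *ᶻ b₁ +ᶻ
   d *ᶻ (a₁ *ᶻ (b₂ *ᶻ v₃ -ᶻ b₃ *ᶻ v₂) +ᶻ a₂ *ᶻ (b₃ *ᶻ v₁ -ᶻ b₁ *ᶻ v₃) +ᶻ a₃ *ᶻ (b₁ *ᶻ v₂ -ᶻ b₂ *ᶻ v₁)) *ᶻ e₁) ≡
  d *ᶻ (a₁ *ᶻ (b₂ *ᶻ e₃ -ᶻ b₃ *ᶻ e₂) +ᶻ a₂ *ᶻ (b₃ *ᶻ e₁ -ᶻ b₁ *ᶻ e₃) +ᶻ a₃ *ᶻ (b₁ *ᶻ e₂ -ᶻ b₂ *ᶻ e₁)) *ᶻ v₁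
cramer₁ = solveℤ-∀

cramer₂ : ∀ d v₁ v₂ v₃ a₁ a₂ a₃ b₁ b₂ b₃ e₁ e₂ e₃ →
  d *ᶻ (v₁ *ᶻ (b₂ *ᶻ e₃ -ᶻ b₃ *ᶻ e₂) +ᶻ v₂ *ᶻ (b₃ *ᶻ e₁ -ᶻ b₁ *ᶻ e₃) +ᶻ v₃ *ᶻ (b₁ *ᶻ e₂ -ᶻ b₂ *ᶻ e₁)) *ᶻ a₂ +ᶻ
  (d *ᶻ (a₁ *ᶻ (v₂ *ᶻ e₃ -ᶻ v₃ *ᶻ e₂) +ᶻ a₂ *ᶻ (v₃ *ᶻ e₁ -ᶻ v₁ *ᶻ e₃) +ᶻ a₃ *ᶻ (v₁ *ᶻ e₂ -ᶻ v₂ *ᶻ e₁)) *ᶻ b₂ +ᶻ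
   d *ᶻ (a₁ *ᶻ (b₂ *ᶻ v₃ -ᶻ b₃ *ᶻ v₂) +ᶻ a₂ *ᶻ (b₃ *ᶻ v₁ -ᶻ b₁ *ᶻ v₃) +ᶻ a₃ *ᶻ (b₁ *ᶻ v₂ -ᶻ b₂ *ᶻ v₁)) *ᶻ e₂) ≡
  d *ᶻ (a₁ *ᶻ (b₂ *ᶻ e₃ -ᶻ b₃ *ᶻ e₂) +ᶻ a₂ *ᶻ (b₃ *ᶻ e₁ -ᶻ b₁ *ᶻ e₃) +ᶻ a₃ *ᶻ (b₁ *ᶻ e₂ -ᶻ b₂ *ᶻ e₁)) *ᶻ v₂
cramer₂ = solveℤ-∀

cramer₃ : ∀ d v₁ v₂ v₃ a₁ a₂ a₃ b₁ b₂ b₃ e₁ e₂ e₃ →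
  d *ᶻ (v₁ *ᶻ (b₂ *ᶻ e₃ -ᶻ b₃ *ᶻ e₂) +ᶻ v₂ *ᶻ (b₃ *ᶻ e₁ -ᶻ b₁ *ᶻ e₃) +ᶻ v₃ *ᶻ (b₁ *ᶻ e₂ -ᶻ b₂ *ᶻ e₁)) *ᶻ a₃ +ᶻ
  (d *ᶻ (a₁ *ᶻ (v₂ *ᶻ e₃ -ᶻ v₃ *ᶻ e₂) +ᶻ a₂ *ᶻ (v₃ *ᶻ e₁ -ᶻ v₁ *ᶻ e₃) +ᶻ a₃ *ᶻ (v₁ *ᶻ e₂ -ᶻ v₂ *ᶻ e₁)) *ᶻ b₃ +ᶻ
   d *ᶻ (a₁ *ᶻ (b₂ *ᶻ v₃ -ᶻ b₃ *ᶻ v₂) +ᶻ a₂ *ᶻ (b₃ *ᶻ v₁ -ᶻ b₁ *ᶻ v₃) +ᶻ a₃ *ᶻ (b₁ *ᶻ v₂ -ᶻ b₂ *ᶻ v₁)) *ᶻ e₃) ≡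
  d *ᶻ (a₁ *ᶻ (b₂ *ᶻ e₃ -ᶻ b₃ *ᶻ e₂) +ᶻ a₂ *ᶻ (b₃ *ᶻ e₁ -ᶻ b₁ *ᶻ e₃) +ᶻ a₃ *ᶻ (b₁ *ᶻ e₂ -ᶻ b₂ *ᶻ e₁)) *ᶻ v₃
cramer₃ = solveℤ-∀

-- Pairing k₁ a + k₂ b + k₃ e with the cross product b × e removes b and e and leaves k₁ times the
-- determinant.
eliminate₁ : ∀ k₁ k₂ k₃ a₁ a₂ a₃ b₁ b₂ b₃ e₁ e₂ e₃ →
  k₁ *ᶻ (a₁ *ᶻ (b₂ *ᶻ e₃ -ᶻ b₃ *ᶻ e₂) +ᶻ a₂ *ᶻ (b₃ *ᶻ e₁ -ᶻ b₁ *ᶻ e₃) +ᶻ a₃ *ᶻ (b₁ *ᶻ e₂ -ᶻ b₂ *ᶻ e₁)) ≡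
  (k₁ *ᶻ a₁ +ᶻ (k₂ *ᶻ b₁ +ᶻ k₃ *ᶻ e₁)) *ᶻ (b₂ *ᶻ e₃ -ᶻ b₃ *ᶻ e₂) +ᶻ (k₁ *ᶻ a₂ +ᶻ (k₂ *ᶻ b₂ +ᶻ k₃ *ᶻ e₂)) *ᶻ (b₃ *ᶻ e₁ -ᶻ b₁ *ᶻ e₃) +ᶻ
  (k₁ *ᶻ a₃ +ᶻ (k₂ *ᶻ b₃ +ᶻ k₃ *ᶻ e₃)) *ᶻ (b₁ *ᶻ e₂ -ᶻ b₂ *ᶻ e₁)
eliminate₁ = solveℤ-∀

eliminate₂ : ∀ k₁ k₂ k₃ a₁ a₂ a₃ b₁ b₂ b₃ e₁ e₂ e₃ →
  k₂ *ᶻ (a₁ *ᶻ (b₂ *ᶻ e₃ -ᶻ b₃ *ᶻ e₂) +ᶻ a₂ *ᶻ (b₃ *ᶻ e₁ -ᶻ b₁ *ᶻ e₃) +ᶻ a₃ *ᶻ (b₁ *ᶻ e₂ -ᶻ b₂ *ᶻ e₁)) ≡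
  (k₁ *ᶻ a₁ +ᶻ (k₂ *ᶻ b₁ +ᶻ k₃ *ᶻ e₁)) *ᶻ (e₂ *ᶻ a₃ -ᶻ e₃ *ᶻ a₂) +ᶻ (k₁ *ᶻ a₂ +ᶻ (k₂ *ᶻ b₂ +ᶻ k₃ *ᶻ e₂)) *ᶻ (e₃ *ᶻ a₁ -ᶻ e₁ *ᶻ a₃) +ᶻ
  (k₁ *ᶻ a₃ +ᶻ (k₂ *ᶻ b₃ +ᶻ k₃ *ᶻ e₃)) *ᶻ (e₁ *ᶻ a₂ -ᶻ e₂ *ᶻ a₁)
eliminate₂ = solveℤ-∀

eliminate₃ : ∀ k₁ k₂ k₃ a₁ a₂ a₃ b₁ b₂ b₃ e₁ e₂ e₃ →
  k₃ *ᶻ (a₁ *ᶻ (b₂ *ᶻ e₃ -ᶻ b₃ *ᶻ e₂) +ᶻ a₂ *ᶻ (b₃ *ᶻ e₁ -ᶻ b₁ *ᶻ e₃) +ᶻ a₃ *ᶻ (b₁ *ᶻ e₂ -ᶻ b₂ *ᶻ e₁)) ≡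
  (k₁ *ᶻ a₁ +ᶻ (k₂ *ᶻ b₁ +ᶻ k₃ *ᶻ e₁)) *ᶻ (a₂ *ᶻ b₃ -ᶻ a₃ *ᶻ b₂) +ᶻ (k₁ *ᶻ a₂ +ᶻ (k₂ *ᶻ b₂ +ᶻ k₃ *ᶻ e₂)) *ᶻ (a₃ *ᶻ b₁ -ᶻ a₁ *ᶻ b₃) +ᶻ
  (k₁ *ᶻ a₃ +ᶻ (k₂ *ᶻ b₃ +ᶻ k₃ *ᶻ e₃)) *ᶻ (a₁ *ᶻ b₂ -ᶻ a₂ *ᶻ b₁)
eliminate₃ = solveℤ-∀

unit-square : ∀ d → ∣ d ∣ ≡ 1 → d *ᶻ d ≡ + 1
unit-square (+ 1)     refl = refl
unit-square -[1+ 0 ]  refl = refl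

zero-combination : ∀ {x y z} p q r → x ≡ + 0 → y ≡ + 0 → z ≡ + 0 → x *ᶻ p +ᶻ y *ᶻ q +ᶻ z *ᶻ r ≡ + 0
zero-combination p q r refl refl refl = refl

cancel-unit : ∀ k d → ∣ d ∣ ≡ 1 → k *ᶻ d ≡ + 0 → k ≡ + 0
cancel-unit k d d-unit eq = begin
  k              ≡⟨ ℤP.*-identityʳ k ⟨
  k *ᶻ + 1        ≡⟨ cong (k *ᶻ_) (unit-square d d-unit) ⟨
  k *ᶻ (d *ᶻ d)    ≡⟨ ℤP.*-assoc k d d ⟨
  k *ᶻ d *ᶻ d      ≡⟨ cong (_*ᶻ d) eq ⟩
  + 0            ∎
  where open ≡-Reasoning

unit⇒basis : ∀ (b : Fin 4 → El) → b zero ≡ oneE →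
  ∣ det (b (suc zero)) (b (suc (suc zero))) (b (suc (suc (suc zero)))) ∣ ≡ 1 → IsIntegralBasis b
unit⇒basis b b₀≡1 d-unit = spanning , independent
  where
  1F 2F 3F : Fin 4
  1F = suc zero
  2F = suc (suc zero)
  3F = suc (suc (suc zero))
  β₁ = b 1F
  β₂ = b 2F
  β₃ = b 3F
  d = det β₁ β₂ β₃
  a₁ = c1 β₁
  a₂ = c2 β₁
  a₃ = c3 β₁
  b₁ = c1 β₂
  b₂ = c2 β₂
  b₃ = c3 β₂
  e₁ = c1 β₃
  e₂ = c2 β₃
  e₃ = c3 β₃
  head : ∀ (k : Fin 4 → ℤ) (c : El → ℤ) → c oneE ≡ + 0 →
    k zero *ᶻ c (b zero) +ᶻ (k 1F *ᶻ c β₁ +ᶻ (k 2F *ᶻ c β₂ +ᶻ k 3F *ᶻ c β₃)) ≡ k 1F *ᶻ c β₁ +ᶻ (k 2F *ᶻ c β₂ +ᶻ k 3F *ᶻ c β₃)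
  head k c c1≡0 = trans (cong (λ t → k zero *ᶻ t +ᶻ (k 1F *ᶻ c β₁ +ᶻ (k 2F *ᶻ c β₂ +ᶻ k 3F *ᶻ c β₃))) (trans (cong c b₀≡1) c1≡0))
    (combine-0 (k zero) (k 1F) (k 2F) (k 3F) (c β₁) (c β₂) (c β₃))
  spanning : ∀ v → ∃[ c ] (linComb c b ≡ v)
  spanning v = k , El-≡
      (trans (cong (λ t → k₀ *ᶻ c0 t +ᶻ rest) b₀≡1) (i₁ v₀ rest))
      (trans (head k c1 refl) (trans (cramer₁ d v₁ v₂ v₃ a₁ a₂ a₃ b₁ b₂ b₃ e₁ e₂ e₃) (scale v₁)))
      (trans (head k c2 refl) (trans (cramer₂ d v₁ v₂ v₃ a₁ a₂ a₃ b₁ b₂ b₃ e₁ e₂ e₃) (scale v₂)))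
      (trans (head k c3 refl) (trans (cramer₃ d v₁ v₂ v₃ a₁ a₂ a₃ b₁ b₂ b₃ e₁ e₂ e₃) (scale v₃)))
    where
    v₀ = c0 v
    v₁ = c1 v
    v₂ = c2 v
    v₃ = c3 v
    k₁ = d *ᶻ (v₁ *ᶻ (b₂ *ᶻ e₃ -ᶻ b₃ *ᶻ e₂) +ᶻ v₂ *ᶻ (b₃ *ᶻ e₁ -ᶻ b₁ *ᶻ e₃) +ᶻ v₃ *ᶻ (b₁ *ᶻ e₂ -ᶻ b₂ *ᶻ e₁))
    k₂ = d *ᶻ (a₁ *ᶻ (v₂ *ᶻ e₃ -ᶻ v₃ *ᶻ e₂) +ᶻ a₂ *ᶻ (v₃ *ᶻ e₁ -ᶻ v₁ *ᶻ e₃) +ᶻ a₃ *ᶻ (v₁ *ᶻ e₂ -ᶻ v₂ *ᶻ e₁))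
    k₃ = d *ᶻ (a₁ *ᶻ (b₂ *ᶻ v₃ -ᶻ b₃ *ᶻ v₂) +ᶻ a₂ *ᶻ (b₃ *ᶻ v₁ -ᶻ b₁ *ᶻ v₃) +ᶻ a₃ *ᶻ (b₁ *ᶻ v₂ -ᶻ b₂ *ᶻ v₁))
    rest = k₁ *ᶻ c0 β₁ +ᶻ (k₂ *ᶻ c0 β₂ +ᶻ k₃ *ᶻ c0 β₃)
    k₀ = v₀ -ᶻ rest
    k : Fin 4 → ℤ
    k zero = k₀
    k (suc zero) = k₁
    k (suc (suc zero)) = k₂
    k (suc (suc (suc zero))) = k₃
    i₁ : ∀ v r → (v -ᶻ r) *ᶻ + 1 +ᶻ r ≡ v
    i₁ = solveℤ-∀
    scale : ∀ w → d *ᶻ d *ᶻ w ≡ w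
    scale w = trans (cong (_*ᶻ w) (unit-square d d-unit)) (ℤP.*-identityˡ w)
  independent : ∀ (k : Fin 4 → ℤ) → linComb k b ≡ zeroE → ∀ i → k i ≡ + 0
  independent k eq = λ { zero → k₀≡0 ; (suc zero) → k₁≡0 ; (suc (suc zero)) → k₂≡0 ; (suc (suc (suc zero))) → k₃≡0 }
    where
    r₁ = trans (sym (head k c1 refl)) (cong c1 eq)
    r₂ = trans (sym (head k c2 refl)) (cong c2 eq)
    r₃ = trans (sym (head k c3 refl)) (cong c3 eq)
    k₁≡0 = cancel-unit (k 1F) d d-unit (trans (eliminate₁ (k 1F) (k 2F) (k 3F) a₁ a₂ a₃ b₁ b₂ b₃ e₁ e₂ e₃) (zero-combination _ _ _ r₁ r₂ r₃))
    k₂≡0 = cancel-unit (k 2F) d d-unit (trans (eliminate₂ (k 1F) (k 2F) (k 3F) a₁ a₂ a₃ b₁ b₂ b₃ e₁ e₂ e₃) (zero-combination _ _ _ r₁ r₂ r₃))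
    k₃≡0 = cancel-unit (k 3F) d d-unit (trans (eliminate₃ (k 1F) (k 2F) (k 3F) a₁ a₂ a₃ b₁ b₂ b₃ e₁ e₂ e₃) (zero-combination _ _ _ r₁ r₂ r₃))
    i₁ : ∀ k p q r → k *ᶻ + 1 +ᶻ (+ 0 *ᶻ p +ᶻ (+ 0 *ᶻ q +ᶻ + 0 *ᶻ r)) ≡ k
    i₁ = solveℤ-∀
    k₀≡0 : k zero ≡ + 0
    k₀≡0 = begin
      k zero                                                                         ≡⟨ i₁ (k zero) (c0 β₁) (c0 β₂) (c0 β₃) ⟨
      k zero *ᶻ + 1 +ᶻ (+ 0 *ᶻ c0 β₁ +ᶻ (+ 0 *ᶻ c0 β₂ +ᶻ + 0 *ᶻ c0 β₃))                     ≡⟨ cong (λ t → k zero *ᶻ c0 t +ᶻ (+ 0 *ᶻ c0 β₁ +ᶻ (+ 0 *ᶻ c0 β₂ +ᶻ + 0 *ᶻ c0 β₃))) b₀≡1 ⟨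
      k zero *ᶻ c0 (b zero) +ᶻ (+ 0 *ᶻ c0 β₁ +ᶻ (+ 0 *ᶻ c0 β₂ +ᶻ + 0 *ᶻ c0 β₃))             ≡⟨ cong₂ (λ p q → k zero *ᶻ c0 (b zero) +ᶻ (p *ᶻ c0 β₁ +ᶻ q)) k₁≡0 (cong₂ (λ p q → p *ᶻ c0 β₂ +ᶻ q *ᶻ c0 β₃) k₂≡0 k₃≡0) ⟨
      k zero *ᶻ c0 (b zero) +ᶻ (k 1F *ᶻ c0 β₁ +ᶻ (k 2F *ᶻ c0 β₂ +ᶻ k 3F *ᶻ c0 β₃))          ≡⟨ cong c0 eq ⟩
      + 0                                                                            ∎
      where open ≡-Reasoning

-- The determinant of the powers of θ

unitary : ∀ x y z M →
  let u₀ = + 0 *ᶻ + 1 +ᶻ M *ᶻ (x *ᶻ + 0 +ᶻ y *ᶻ + 0 +ᶻ z *ᶻ + 0)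
      u₁ = + 0 *ᶻ + 0 +ᶻ x *ᶻ + 1 +ᶻ M *ᶻ (y *ᶻ + 0 +ᶻ z *ᶻ + 0)
      u₂ = + 0 *ᶻ + 0 +ᶻ x *ᶻ + 0 +ᶻ y *ᶻ + 1 +ᶻ M *ᶻ (z *ᶻ + 0)
      u₃ = + 0 *ᶻ + 0 +ᶻ x *ᶻ + 0 +ᶻ y *ᶻ + 0 +ᶻ z *ᶻ + 1 in
  ⟨ u₀ , u₁ , u₂ , u₃ ⟩ ≡ elt x y z
unitary x y z M = El-≡ (e₀ x y z M) (e₁ x y z M) (e₂ x y z M) (e₃ x y z)
  where
  e₀ : ∀ x y z M → + 0 *ᶻ + 1 +ᶻ M *ᶻ (x *ᶻ + 0 +ᶻ y *ᶻ + 0 +ᶻ z *ᶻ + 0) ≡ + 0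
  e₀ = solveℤ-∀
  e₁ : ∀ x y z M → + 0 *ᶻ + 0 +ᶻ x *ᶻ + 1 +ᶻ M *ᶻ (y *ᶻ + 0 +ᶻ z *ᶻ + 0) ≡ x
  e₁ = solveℤ-∀
  e₂ : ∀ x y z M → + 0 *ᶻ + 0 +ᶻ x *ᶻ + 0 +ᶻ y *ᶻ + 1 +ᶻ M *ᶻ (z *ᶻ + 0) ≡ y
  e₂ = solveℤ-∀
  e₃ : ∀ x y z → + 0 *ᶻ + 0 +ᶻ x *ᶻ + 0 +ᶻ y *ᶻ + 0 +ᶻ z *ᶻ + 1 ≡ z
  e₃ = solveℤ-∀

-- The two differences of conjugates of θ under α ↦ -α give N, the norm of x + z √m. Each of the
-- other four is, up to a factor depending on α only, x + y ζ + z ζ² / 2 with ζ⁴ = -4 m; the product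
-- of these is N² + 4 m t².
index : ℤ → ℤ → ℤ → ℤ → ℤ
index M x y z = let N = x *ᶻ x -ᶻ M *ᶻ (z *ᶻ z)
                    t = x *ᶻ z -ᶻ y *ᶻ y in N *ᶻ (N *ᶻ N +ᶻ + 4 *ᶻ M *ᶻ (t *ᶻ t))

index-identity : ∀ x y z M →
  let s₀ = + 0 *ᶻ + 0 +ᶻ M *ᶻ (x *ᶻ z +ᶻ y *ᶻ y +ᶻ z *ᶻ x)
      s₁ = + 0 *ᶻ x +ᶻ x *ᶻ + 0 +ᶻ M *ᶻ (y *ᶻ z +ᶻ z *ᶻ y)
      s₂ = + 0 *ᶻ y +ᶻ x *ᶻ x +ᶻ y *ᶻ + 0 +ᶻ M *ᶻ (z *ᶻ z)
      s₃ = + 0 *ᶻ z +ᶻ x *ᶻ y +ᶻ y *ᶻ x +ᶻ z *ᶻ + 0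
      q₁ = + 0 *ᶻ s₁ +ᶻ x *ᶻ s₀ +ᶻ M *ᶻ (y *ᶻ s₃ +ᶻ z *ᶻ s₂)
      q₂ = + 0 *ᶻ s₂ +ᶻ x *ᶻ s₁ +ᶻ y *ᶻ s₀ +ᶻ M *ᶻ (z *ᶻ s₃)
      q₃ = + 0 *ᶻ s₃ +ᶻ x *ᶻ s₂ +ᶻ y *ᶻ s₁ +ᶻ z *ᶻ s₀ in
  x *ᶻ (s₂ *ᶻ q₃ -ᶻ s₃ *ᶻ q₂) +ᶻ y *ᶻ (s₃ *ᶻ q₁ -ᶻ s₁ *ᶻ q₃) +ᶻ z *ᶻ (s₁ *ᶻ q₂ -ᶻ s₂ *ᶻ q₁) ≡ index M x y z
index-identity = expanded
  where
  expanded : ∀ x y z M → x *ᶻ ((+ 0 *ᶻ y +ᶻ x *ᶻ x +ᶻ y *ᶻ + 0 +ᶻ M *ᶻ (z *ᶻ z)) *ᶻ (+ 0 *ᶻ (+ 0 *ᶻ z +ᶻ x *ᶻ y +ᶻ y *ᶻ x +ᶻ z *ᶻ + 0) +ᶻ x *ᶻ (+ 0 *ᶻ y +ᶻ x *ᶻ x +ᶻ y *ᶻ + 0 +ᶻ M *ᶻ (z *ᶻ z)) +ᶻ y *ᶻ (+ 0 *ᶻ x +ᶻ x *ᶻ + 0 +ᶻ M *ᶻ (y *ᶻ z +ᶻ z *ᶻ y)) +ᶻ z *ᶻ (+ 0 *ᶻ + 0 +ᶻ M *ᶻ (x *ᶻ z +ᶻ y *ᶻ y +ᶻ z *ᶻ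 x))) -ᶻ (+ 0 *ᶻ z +ᶻ x *ᶻ y +ᶻ y *ᶻ x +ᶻ z *ᶻ + 0) *ᶻ (+ 0 *ᶻ (+ 0 *ᶻ y +ᶻ x *ᶻ x +ᶻ y *ᶻ + 0 +ᶻ M *ᶻ (z *ᶻ z)) +ᶻ x *ᶻ (+ 0 *ᶻ x +ᶻ x *ᶻ + 0 +ᶻ M *ᶻ (y *ᶻ z +ᶻ z *ᶻ y)) +ᶻ y *ᶻ (+ 0 *ᶻ + 0 +ᶻ M *ᶻ (x *ᶻ z +ᶻ y *ᶻ y +ᶻ z *ᶻ x)) +ᶻ M *ᶻ (z *ᶻ (+ 0 *ᶻ z +ᶻ x *ᶻ y +ᶻ y *ᶻ x +ᶻ z *ᶻ + 0)))) +ᶻ y *ᶻ ((+ 0 *ᶻ z +ᶻ x *ᶻ y +ᶻ y *ᶻ x +ᶻ z *ᶻ + 0) *ᶻ (+ 0 *ᶻ (+ 0 *ᶻ x +ᶻ x *ᶻ + 0 +ᶻ M *ᶻ (y *ᶻ z +ᶻ z *ᶻ y)) +ᶻ x *ᶻ (+ 0 *ᶻ + 0 +ᶻ M *ᶻ (x *ᶻ z +ᶻ y *ᶻ y +ᶻ z *ᶻ x)) +ᶻ M *ᶻ (y *ᶻ (+ 0 *ᶻ z +ᶻ x *ᶻ y +ᶻ y *ᶻ x +ᶻ z *ᶻ + 0) +ᶻ z *ᶻ (+ 0 *ᶻ y +ᶻ x *ᶻ x +ᶻ y *ᶻ + 0 +ᶻ M *ᶻ (z *ᶻ z)))) -ᶻ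 (+ 0 *ᶻ x +ᶻ x *ᶻ + 0 +ᶻ M *ᶻ (y *ᶻ z +ᶻ z *ᶻ y)) *ᶻ (+ 0 *ᶻ (+ 0 *ᶻ z +ᶻ x *ᶻ y +ᶻ y *ᶻ x +ᶻ z *ᶻ + 0) +ᶻ x *ᶻ (+ 0 *ᶻ y +ᶻ x *ᶻ x +ᶻ y *ᶻ + 0 +ᶻ M *ᶻ (z *ᶻ z)) +ᶻ y *ᶻ (+ 0 *ᶻ x +ᶻ x *ᶻ + 0 +ᶻ M *ᶻ (y *ᶻ z +ᶻ z *ᶻ y)) +ᶻ z *ᶻ (+ 0 *ᶻ + 0 +ᶻ M *ᶻ (x *ᶻ z +ᶻ y *ᶻ y +ᶻ z *ᶻ x)))) +ᶻ z *ᶻ ((+ 0 *ᶻ x +ᶻ x *ᶻ + 0 +ᶻ M *ᶻ (y *ᶻ z +ᶻ z *ᶻ y)) *ᶻ (+ 0 *ᶻ (+ 0 *ᶻ y +ᶻ x *ᶻ x +ᶻ y *ᶻ + 0 +ᶻ M *ᶻ (z *ᶻ z)) +ᶻ x *ᶻ (+ 0 *ᶻ x +ᶻ x *ᶻ + 0 +ᶻ M *ᶻ (y *ᶻ z +ᶻ z *ᶻ y)) +ᶻ y *ᶻ (+ 0 *ᶻ + 0 +ᶻ M *ᶻ (x *ᶻ z +ᶻ y *ᶻ y +ᶻ z *ᶻ x)) +ᶻ M *ᶻ (z *ᶻ (+ 0 *ᶻ z +ᶻ x *ᶻ y +ᶻ y *ᶻ x +ᶻ z *ᶻ + 0))) -ᶻ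 (+ 0 *ᶻ y +ᶻ x *ᶻ x +ᶻ y *ᶻ + 0 +ᶻ M *ᶻ (z *ᶻ z)) *ᶻ (+ 0 *ᶻ (+ 0 *ᶻ x +ᶻ x *ᶻ + 0 +ᶻ M *ᶻ (y *ᶻ z +ᶻ z *ᶻ y)) +ᶻ x *ᶻ (+ 0 *ᶻ + 0 +ᶻ M *ᶻ (x *ᶻ z +ᶻ y *ᶻ y +ᶻ z *ᶻ x)) +ᶻ M *ᶻ (y *ᶻ (+ 0 *ᶻ z +ᶻ x *ᶻ y +ᶻ y *ᶻ x +ᶻ z *ᶻ + 0) +ᶻ z *ᶻ (+ 0 *ᶻ y +ᶻ x *ᶻ x +ᶻ y *ᶻ + 0 +ᶻ M *ᶻ (z *ᶻ z))))) ≡ (x *ᶻ x -ᶻ M *ᶻ (z *ᶻ z)) *ᶻ ((x *ᶻ x -ᶻ M *ᶻ (z *ᶻ z)) *ᶻ (x *ᶻ x -ᶻ M *ᶻ (z *ᶻ z)) +ᶻ + 4 *ᶻ M *ᶻ ((x *ᶻ z -ᶻ y *ᶻ y) *ᶻ (x *ᶻ z -ᶻ y *ᶻ y)))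
  expanded = solveℤ-∀

det-powers : ∀ m x y z → det (powE m (elt x y z) 1) (powE m (elt x y z) 2) (powE m (elt x y z) 3) ≡ index (+ m) x y z
det-powers m x y z = trans
  (cong (λ u → det u (mulE m (elt x y z) u) (mulE m (elt x y z) (mulE m (elt x y z) u))) (unitary x y z (+ m)))
  (index-identity x y z (+ m))

index-neg : ∀ M x y z → index M (-ᶻ x) (-ᶻ y) (-ᶻ z) ≡ index M x y z
index-neg M x y z = expanded M x y z
  where
  expanded : ∀ M x y z → (-ᶻ x *ᶻ -ᶻ x -ᶻ M *ᶻ (-ᶻ z *ᶻ -ᶻ z)) *ᶻ ((-ᶻ x *ᶻ -ᶻ x -ᶻ M *ᶻ (-ᶻ z *ᶻ -ᶻ z)) *ᶻ (-ᶻ x *ᶻ -ᶻ x -ᶻ M *ᶻ (-ᶻ z *ᶻ -ᶻ z)) +ᶻ + 4 *ᶻ M *ᶻ ((-ᶻ x *ᶻ -ᶻ z -ᶻ -ᶻ y *ᶻ -ᶻ y) *ᶻ (-ᶻ x *ᶻ -ᶻ z -ᶻ -ᶻ y *ᶻ -ᶻ y))) ≡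
    (x *ᶻ x -ᶻ M *ᶻ (z *ᶻ z)) *ᶻ ((x *ᶻ x -ᶻ M *ᶻ (z *ᶻ z)) *ᶻ (x *ᶻ x -ᶻ M *ᶻ (z *ᶻ z)) +ᶻ + 4 *ᶻ M *ᶻ ((x *ᶻ z -ᶻ y *ᶻ y) *ᶻ (x *ᶻ z -ᶻ y *ᶻ y)))
  expanded = solveℤ-∀

index-neg-y : ∀ M x y z → index M x (-ᶻ y) z ≡ index M x y z
index-neg-y M x y z = expanded M x y z
  where
  expanded : ∀ M x y z → (x *ᶻ x -ᶻ M *ᶻ (z *ᶻ z)) *ᶻ ((x *ᶻ x -ᶻ M *ᶻ (z *ᶻ z)) *ᶻ (x *ᶻ x -ᶻ M *ᶻ (z *ᶻ z)) +ᶻ + 4 *ᶻ M *ᶻ ((x *ᶻ z -ᶻ -ᶻ y *ᶻ -ᶻ y) *ᶻ (x *ᶻ z -ᶻ -ᶻ y *ᶻ -ᶻ y))) ≡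
    (x *ᶻ x -ᶻ M *ᶻ (z *ᶻ z)) *ᶻ ((x *ᶻ x -ᶻ M *ᶻ (z *ᶻ z)) *ᶻ (x *ᶻ x -ᶻ M *ᶻ (z *ᶻ z)) +ᶻ + 4 *ᶻ M *ᶻ ((x *ᶻ z -ᶻ y *ᶻ y) *ᶻ (x *ᶻ z -ᶻ y *ᶻ y)))
  expanded = solveℤ-∀

index-one : ∀ M → index M (+ 1) (+ 0) (+ 0) ≡ + 1
index-one M = expanded M
  where
  expanded : ∀ M → (+ 1 *ᶻ + 1 -ᶻ M *ᶻ (+ 0 *ᶻ + 0)) *ᶻ ((+ 1 *ᶻ + 1 -ᶻ M *ᶻ (+ 0 *ᶻ + 0)) *ᶻ (+ 1 *ᶻ + 1 -ᶻ M *ᶻ (+ 0 *ᶻ + 0)) +ᶻ + 4 *ᶻ M *ᶻ ((+ 1 *ᶻ + 0 -ᶻ + 0 *ᶻ + 0) *ᶻ (+ 1 *ᶻ + 0 -ᶻ + 0 *ᶻ + 0))) ≡ + 1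
  expanded = solveℤ-∀

generates⇒unit : ∀ m x y z → GeneratesPIB m (elt x y z) → ∣ index (+ m) x y z ∣ ≡ 1
generates⇒unit m x y z (spanning , _) = trans (cong ∣_∣ (sym (det-powers m x y z)))
  (spanning⇒unit (λ i → powE m (elt x y z) (Data.Fin.toℕ i)) refl spanning)

unit⇒generates : ∀ m x y z → ∣ index (+ m) x y z ∣ ≡ 1 → GeneratesPIB m (elt x y z)
unit⇒generates m x y z eq = unit⇒basis (λ i → powE m (elt x y z) (Data.Fin.toℕ i)) refl
  (trans (cong ∣_∣ (det-powers m x y z)) eq)

-- From unit index to the quartic equation

abs-square : ∀ i → i *ᶻ i ≡ + (∣ i ∣ * ∣ i ∣)
abs-square (+ n)    = sym (ℤP.pos-* n n)
abs-square -[1+ n ] = refl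

-- Both factors are units. As N² = 1, the second one is 1 + 4 m t², so t = 0.
index-factors : ∀ m x y z → 1 ≤ m → ∣ index (+ m) x y z ∣ ≡ 1 →
  ∣ x *ᶻ x -ᶻ + m *ᶻ (z *ᶻ z) ∣ ≡ 1 × x *ᶻ z ≡ y *ᶻ y
index-factors m x y z m≥1 eq = N-unit , ℤP.i-j≡0⇒i≡j (x *ᶻ z) (y *ᶻ y) (ℤP.∣i∣≡0⇒i≡0 T≡0)
  where
  N = x *ᶻ x -ᶻ + m *ᶻ (z *ᶻ z)
  t = x *ᶻ z -ᶻ y *ᶻ y
  T′ = ∣ t ∣
  product : ∣ N ∣ * ∣ N *ᶻ N +ᶻ + 4 *ᶻ + m *ᶻ (t *ᶻ t) ∣ ≡ 1
  product = trans (sym (ℤP.abs-* N (N *ᶻ N +ᶻ + 4 *ᶻ + m *ᶻ (t *ᶻ t)))) eq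
  N-unit : ∣ N ∣ ≡ 1
  N-unit = m*n≡1⇒m≡1 ∣ N ∣ ∣ N *ᶻ N +ᶻ + 4 *ᶻ + m *ᶻ (t *ᶻ t) ∣ product
  second : N *ᶻ N +ᶻ + 4 *ᶻ + m *ᶻ (t *ᶻ t) ≡ + (1 + 4 * m * (T′ * T′))
  second = cong₂ (λ p q → p +ᶻ q) (unit-square N N-unit)
    (trans (cong₂ (λ p q → p *ᶻ q) (sym (ℤP.pos-* 4 m)) (abs-square t)) (sym (ℤP.pos-* (4 * m) (T′ * T′))))
  vanishing : 4 * m * (T′ * T′) ≡ 0
  vanishing = suc-injective (trans (cong ∣_∣ (sym second)) (m*n≡1⇒n≡1 ∣ N ∣ ∣ N *ᶻ N +ᶻ + 4 *ᶻ + m *ᶻ (t *ᶻ t) ∣ product))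
  T≡0 : T′ ≡ 0
  T≡0 = n<1⇒n≡0 (≰⇒> λ T≥1 → contradiction vanishing (m<n⇒n≢0 (*-mono-≤ (*-mono-≤ (s≤s (z≤n {3})) m≥1) (*-mono-≤ T≥1 T≥1))))

norm-equation : ∀ m x z → ∣ x *ᶻ x -ᶻ + m *ᶻ (z *ᶻ z) ∣ ≡ 1 → let X = ∣ x ∣ ; Z = ∣ z ∣ in
  X * X + 1 ≡ m * (Z * Z) ⊎ X * X ≡ m * (Z * Z) + 1
norm-equation m x z eq = split (x *ᶻ x -ᶻ + m *ᶻ (z *ᶻ z)) eq refl
  where
  X = ∣ x ∣
  Z = ∣ z ∣
  q = + m *ᶻ (z *ᶻ z)
  q≡ : q ≡ + (m * (Z * Z))
  q≡ = trans (cong (+ m *ᶻ_) (abs-square z)) (sym (ℤP.pos-* m (Z * Z)))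
  i₁ : ∀ p q → p ≡ q +ᶻ (p -ᶻ q)
  i₁ = solveℤ-∀
  i₂ : ∀ p q → p -ᶻ (p -ᶻ q) ≡ q
  i₂ = solveℤ-∀
  split : ∀ n → ∣ n ∣ ≡ 1 → x *ᶻ x -ᶻ q ≡ n → X * X + 1 ≡ m * (Z * Z) ⊎ X * X ≡ m * (Z * Z) + 1
  split (+ 1)     refl e = inj₂ (ℤP.+-injective (trans (sym (abs-square x)) (trans (i₁ (x *ᶻ x) q) (cong₂ (λ p r → p +ᶻ r) q≡ e))))
  split -[1+ 0 ]  refl e = inj₁ (ℤP.+-injective (trans (cong (_+ᶻ + 1) (sym (abs-square x))) (trans (cong (λ n → x *ᶻ x -ᶻ n) (sym e)) (trans (i₂ (x *ᶻ x) q) q≡))))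

norm-coprime : ∀ m X Z → X * X + 1 ≡ m * (Z * Z) ⊎ X * X ≡ m * (Z * Z) + 1 → Coprime X Z
norm-coprime m X Z (inj₁ eq) {i} (i∣X , i∣Z) = ∣1⇒≡1 (∣m+n∣m⇒∣n (subst (i ∣_) (sym eq) (∣n⇒∣m*n m (∣m⇒∣m*n Z i∣Z))) (∣m⇒∣m*n X i∣X))
norm-coprime m X Z (inj₂ eq) {i} (i∣X , i∣Z) = ∣1⇒≡1 (∣m+n∣m⇒∣n (subst (i ∣_) eq (∣m⇒∣m*n X i∣X)) (∣n⇒∣m*n m (∣m⇒∣m*n Z i∣Z)))

-- The norm equation makes X and Z coprime, so X Z = Y² makes each of them a square.
absolute-listed : ∀ {m} X Y Z → Admissible m → 1 ≤ Z → X < 10 ^ 1000 → X * Z ≡ Y * Y →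
  X * X + 1 ≡ m * (Z * Z) ⊎ X * X ≡ m * (Z * Z) + 1 → (m , + X , + Y , + Z) ∈ table
absolute-listed {m} X Y Z adm Z≥1 X< XZ≡Y² norm = conclude (coprime-square X Z Y cop XZ≡Y²)
    (coprime-square Z X Y (Coprimality.sym cop) (trans (*-comm Z X) XZ≡Y²))
  where
  cop = norm-coprime m X Z norm
  conclude : ∃[ a ] (X ≡ a * a) → ∃[ b ] (Z ≡ b * b) → (m , + X , + Y , + Z) ∈ table
  conclude (a , X≡) (b , Z≡) = subst (_∈ table) (cong₂ (λ p q → m , + p , q) (sym X≡) (cong₂ (λ p q → + p , + q) (sym Y≡) (sym Z≡)))
    (quartic-listed a b adm b≥1 (subst₂ (λ X Z → X * X + 1 ≡ m * (Z * Z) ⊎ X * X ≡ m * (Z * Z) + 1) X≡ Z≡ norm) (subst (_< 10 ^ 1000) X≡ X<))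
    where
    b≥1 : 1 ≤ b
    b≥1 = n≢0⇒n>0 λ b≡0 → contradiction (trans Z≡ (cong (λ b → b * b) b≡0)) (m<n⇒n≢0 Z≥1)
    Y≡ : Y ≡ a * b
    Y≡ = square-injective (trans (sym XZ≡Y²) (trans (cong₂ _*_ X≡ Z≡) (interchange a b)))

claimed-when-nonnegative : ∀ {m} x y z → (m , + ∣ x ∣ , + ∣ y ∣ , + ∣ z ∣) ∈ table → + ∣ x ∣ ≡ x → + ∣ z ∣ ≡ z → Listed m x y z
claimed-when-nonnegative {m} x y z listed x≡ z≡ = choose (ℤP.+∣i∣≡i⊎+∣i∣≡-i y)
  where
  entry : ∀ {w} → + ∣ y ∣ ≡ w → (m , x , w , z) ∈ table
  entry y≡ = subst (_∈ table) (cong₂ (λ p q → m , p , q) x≡ (cong₂ _,_ y≡ z≡)) listed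
  choose : + ∣ y ∣ ≡ y ⊎ + ∣ y ∣ ≡ -ᶻ y → Listed m x y z
  choose (inj₁ y≡) = inj₁ (entry y≡)
  choose (inj₂ y≡) = inj₂ (entry y≡)

x*0≢norm : ∀ m X → X * X + 1 ≡ m * 0 ⊎ X * X ≡ m * 0 + 1 → X ≡ 1
x*0≢norm m X (inj₁ eq) = contradiction (trans (+-comm 1 (X * X)) (trans eq (*-zeroʳ m))) λ ()
x*0≢norm m X (inj₂ eq) = m*n≡1⇒m≡1 X X (trans eq (cong (_+ 1) (*-zeroʳ m)))

opposite-signs : ∀ X Z y → 1 ≤ Z → 1 ≤ X → -ᶻ (+ X *ᶻ + Z) ≢ y *ᶻ y
opposite-signs (suc X) (suc Z) y _ _ eq = contradiction (trans eq (abs-square y)) λ ()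

unit⇒claimed : ∀ m x y z → Admissible m → ∣ x ∣ < 10 ^ 1000 → ∣ index (+ m) x y z ∣ ≡ 1 → ClaimedGenerator m (elt x y z)
unit⇒claimed m x y z adm x< eq = byZ ∣ z ∣ refl
  where
  m≥1 : 1 ≤ m
  m≥1 = <⇒≤ (Admissible.m>1 adm)
  xz≡y² = proj₂ (index-factors m x y z m≥1 eq)
  norm = norm-equation m x z (proj₁ (index-factors m x y z m≥1 eq))
  XZ≡Y² : ∣ x ∣ * ∣ z ∣ ≡ ∣ y ∣ * ∣ y ∣
  XZ≡Y² = trans (sym (ℤP.abs-* x z)) (trans (cong ∣_∣ xz≡y²) (ℤP.abs-* y y))
  trivial : ∀ x y z → ∣ x ∣ ≡ 1 → ∣ y ∣ ≡ 0 → ∣ z ∣ ≡ 0 → Equiv (elt x y z) (elt (+ 1) (+ 0) (+ 0))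
  trivial (+ 1)    (+ 0) (+ 0) refl refl refl = inj₂ (refl , refl , refl)
  trivial -[1+ 0 ] (+ 0) (+ 0) refl refl refl = inj₁ (refl , refl , refl)
  byZ : ∀ Z → ∣ z ∣ ≡ Z → ClaimedGenerator m (elt x y z)
  byZ zero Z≡ = inj₁ (trivial x y z
    (x*0≢norm m ∣ x ∣ (subst (λ Z → ∣ x ∣ * ∣ x ∣ + 1 ≡ m * (Z * Z) ⊎ ∣ x ∣ * ∣ x ∣ ≡ m * (Z * Z) + 1) Z≡ norm))
    (square-injective {b = 0} (trans (sym XZ≡Y²) (trans (cong (∣ x ∣ *_) Z≡) (*-zeroʳ ∣ x ∣))))
    Z≡)
  byZ (suc k) Z≡ = bySigns (ℤP.+∣i∣≡i⊎+∣i∣≡-i x) (ℤP.+∣i∣≡i⊎+∣i∣≡-i z)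
    where
    Z≥1 : 1 ≤ ∣ z ∣
    Z≥1 = subst (1 ≤_) (sym Z≡) (s≤s z≤n)
    listed = absolute-listed (∣ x ∣) (∣ y ∣) (∣ z ∣) adm Z≥1 x< XZ≡Y² norm
    X≥1 : 1 ≤ ∣ x ∣
    X≥1 = n≢0⇒n>0 λ X≡0 → small (subst (λ X → X * X + 1 ≡ m * (∣ z ∣ * ∣ z ∣) ⊎ X * X ≡ m * (∣ z ∣ * ∣ z ∣) + 1) X≡0 norm)
      where
      m≤ : 2 ≤ m * (∣ z ∣ * ∣ z ∣)
      m≤ = *-mono-≤ (Admissible.m>1 adm) (*-mono-≤ Z≥1 Z≥1)
      small : ¬ (1 ≡ m * (∣ z ∣ * ∣ z ∣) ⊎ 0 ≡ m * (∣ z ∣ * ∣ z ∣) + 1)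
      small (inj₁ e) = contradiction m≤ (<⇒≱ (s≤s (≤-reflexive (sym e))))
      small (inj₂ e) = contradiction (trans e (+-comm _ 1)) λ ()
    -- As x z = y² is positive, x and z have the same sign; if both are negative, θ is replaced by
    -- the equivalent -θ.
    bySigns : + ∣ x ∣ ≡ x ⊎ + ∣ x ∣ ≡ -ᶻ x → + ∣ z ∣ ≡ z ⊎ + ∣ z ∣ ≡ -ᶻ z → ClaimedGenerator m (elt x y z)
    bySigns (inj₁ x≡) (inj₁ z≡) = inj₂ (x , y , z , claimed-when-nonnegative x y z listed x≡ z≡ ,
      inj₂ (ℤP.+-inverseʳ x , ℤP.+-inverseʳ y , ℤP.+-inverseʳ z))
    bySigns (inj₂ x≡) (inj₂ z≡) = inj₂ (-ᶻ x , -ᶻ y , -ᶻ z ,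
      claimed-when-nonnegative (-ᶻ x) (-ᶻ y) (-ᶻ z)
        (subst (_∈ table) (cong₂ (λ p q → m , + p , q) (sym (ℤP.∣-i∣≡∣i∣ x)) (cong₂ (λ p q → + p , + q) (sym (ℤP.∣-i∣≡∣i∣ y)) (sym (ℤP.∣-i∣≡∣i∣ z)))) listed)
        (trans (cong +_ (ℤP.∣-i∣≡∣i∣ x)) x≡) (trans (cong +_ (ℤP.∣-i∣≡∣i∣ z)) z≡) ,
      inj₁ (ℤP.+-inverseʳ x , ℤP.+-inverseʳ y , ℤP.+-inverseʳ z))
    bySigns (inj₁ x≡) (inj₂ z≡) = contradiction
      (trans (trans (cong (λ i → -ᶻ i) (cong₂ (λ p q → p *ᶻ q) x≡ z≡)) (i₁ x z)) xz≡y²) (opposite-signs (∣ x ∣) (∣ z ∣) y Z≥1 X≥1)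
      where
      i₁ : ∀ x z → -ᶻ (x *ᶻ -ᶻ z) ≡ x *ᶻ z
      i₁ = solveℤ-∀
    bySigns (inj₂ x≡) (inj₁ z≡) = contradiction
      (trans (trans (cong (λ i → -ᶻ i) (cong₂ (λ p q → p *ᶻ q) x≡ z≡)) (i₁ x z)) xz≡y²) (opposite-signs (∣ x ∣) (∣ z ∣) y Z≥1 X≥1)
      where
      i₁ : ∀ x z → -ᶻ (-ᶻ x *ᶻ z) ≡ x *ᶻ z
      i₁ = solveℤ-∀

-- The listed elements generate

indexOne : ℕ × ℤ × ℤ × ℤ → Bool
indexOne (m , x , y , z) = ∣ index (+ m) x y z ∣ ≡ᵇ 1

abstract
  table-indexOne : Verified (all indexOne table)
  table-indexOne = verified refl

listed⇒unit : ∀ m x y z → Listed m x y z → ∣ index (+ m) x y z ∣ ≡ 1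
listed⇒unit m x y z (inj₁ e) = ≡ᵇ⇒≡ _ 1 (lookup (all⁺ indexOne table (holds table-indexOne)) e)
listed⇒unit m x y z (inj₂ e) = trans (cong ∣_∣ (sym (index-neg-y (+ m) x y z)))
  (≡ᵇ⇒≡ _ 1 (lookup (all⁺ indexOne table (holds table-indexOne)) e))

sum-zero : ∀ x x′ → x +ᶻ x′ ≡ + 0 → x ≡ -ᶻ x′
sum-zero x x′ eq = trans (i₁ x x′) (trans (cong (_+ᶻ -ᶻ x′) eq) (ℤP.+-identityˡ (-ᶻ x′)))
  where
  i₁ : ∀ x x′ → x ≡ x +ᶻ x′ +ᶻ -ᶻ x′
  i₁ = solveℤ-∀

-- N and t are quadratic forms in x, y, z, so they do not change under θ ↦ -θ, the only freedom that
-- equivalence leaves to elements without constant term.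
equiv-index : ∀ M x y z x′ y′ z′ → Equiv (elt x y z) (elt x′ y′ z′) → index M x y z ≡ index M x′ y′ z′
equiv-index M x y z x′ y′ z′ (inj₁ (ex , ey , ez)) = trans
  (cong₂ (λ x (y , z) → index M x y z) (sum-zero x x′ ex) (cong₂ _,_ (sum-zero y y′ ey) (sum-zero z z′ ez)))
  (index-neg M x′ y′ z′)
equiv-index M x y z x′ y′ z′ (inj₂ (ex , ey , ez)) =
  cong₂ (λ x (y , z) → index M x y z) (ℤP.i-j≡0⇒i≡j x x′ ex) (cong₂ _,_ (ℤP.i-j≡0⇒i≡j y y′ ey) (ℤP.i-j≡0⇒i≡j z z′ ez))

claimed⇒unit : ∀ m x y z → ClaimedGenerator m (elt x y z) → ∣ index (+ m) x y z ∣ ≡ 1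
claimed⇒unit m x y z (inj₁ e) = cong ∣_∣ (trans (equiv-index (+ m) x y z (+ 1) (+ 0) (+ 0) e) (index-one (+ m)))
claimed⇒unit m x y z (inj₂ (x′ , y′ , z′ , listed , e)) = trans (cong ∣_∣ (equiv-index (+ m) x y z x′ y′ z′ e)) (listed⇒unit m x′ y′ z′ listed)

theorem5 : (m : ℕ) → 1 < m → m < 10 ^ 7 → SquareFree m →
    (m % 4 ≡ 2 ⊎ m % 4 ≡ 3) →
    (x y z : ℤ) →
    ∣ x ∣ < 10 ^ 1000 → ∣ y ∣ < 10 ^ 1000 → ∣ z ∣ < 10 ^ 1000 →
    (GeneratesPIB m (elt x y z) ⇔ ClaimedGenerator m (elt x y z))
theorem5 m m>1 m<10⁷ sf m%4 x y z x< _ _ = mk⇔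
  (λ gen → unit⇒claimed m x y z (admissible m>1 m<10⁷ sf m%4) x< (generates⇒unit m x y z gen))
  (λ claimed → unit⇒generates m x y z (claimed⇒unit m x y z claimed))
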